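{- Let $H$ be any $(D^4,D,1/5)$-graph. Define a sequence of graphs by $G_1=H^2$ and $G_{i+1}=$ the zig-zag product of $G_i^2$ (as the large graph) with $H$ (as the small graph), for $i\ge1$. Then for every $i\ge 1$, $G_i$ is an $(N_i,D^2,2/5)$-graph with $N_i=D^{4i}$.
   Context: For a positive integer $n$, $[n]=\{1,\dots,n\}$. Graphs are finite, undirected and regular, and may have self-loops and parallel edges. A $D$-regular graph $G$ on $[N]$ is specified by its rotation map $\mathrm{Rot}_G:[N]\times[D]\to[N]\times[D]$: $\mathrm{Rot}_G(v,i)=(w,j)$ means that the $i$-th edge incident to $v$ leads to $w$ and that this edge is the $j$-th edge incident to $w$. Thus $\mathrm{Rot}_G$ is a permutation with $\mathrm{Rot}_G\circ\mathrm{Rot}_G=\mathrm{id}$ (and any such involution specifies a $D$-regular graph). Vertex sets and sets of edge labels may be any finite sets of the right cardinality; when needed they are identified with sets $[n]$ by fixed bijections (e.g. the edge-label set of $G_i^2$, of size $D^4$, is identified with the vertex set of $H$). The normalized adjacency matrix of $G$ is the symmetric $N\times N$ matrix with $M_{u,v}=\frac1D|\{(i,j)\in[D]^2:\mathrm{Rot}_G(u,i)=(v,j)\}|$. The second largest eigenvalue in absolute value is $\lambda(G)=\max_{\alpha\perp 1_N,\,\alpha\ne0}\|M\alpha\|/\|\alpha\|$, where $1_N$ is the all-ones vector and the norm is Euclidean (with $\lambda(G)=0$ if $N=1$). An $(N,D,\lambda)$-graph is a $D$-regular graph on $N$ vertices with $\lambda(G)\le\lambda$. Square: $G^2$ is the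 $D^2$-regular graph on the vertices of $G$ with $\mathrm{Rot}_{G^2}(v_0,(k_1,k_2))=(v_2,(\ell_2,\ell_1))$, where $(v_1,\ell_1)=\mathrm{Rot}_G(v_0,k_1)$ and $(v_2,\ell_2)=\mathrm{Rot}_G(v_1,k_2)$. Zig-zag product: for a $D_1$-regular graph $G_1$ on $[N_1]$ (the large graph) and a $D_2$-regular graph $G_2$ on $[D_1]$ (the small graph), it is the $D_2^2$-regular graph on $[N_1]\times[D_1]$, with edge labels in $[D_2]\times[D_2]$, whose rotation map sends $((v,k),(i,j))$ to $((w,\ell),(j',i'))$, where $(k',i')=\mathrm{Rot}_{G_2}(k,i)$, then $(w,\ell')=\mathrm{Rot}_{G_1}(v,k')$, then $(\ell,j')=\mathrm{Rot}_{G_2}(\ell',j)$. -}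

module Defs where

open import Data.Bool.Base using (if_then_else_)
open import Data.Fin.Base using (Fin)
open import Data.Fin.Properties using (*↔×; inj⇒≟)
open import Data.Integer.Base as ℤ using ()
import Data.Integer.Properties as ℤ
open import Data.List.Base as List using (List; length; filter; cartesianProduct)
open import Data.Nat.Base as ℕ using (ℕ; zero; suc; _⊔_; NonZero)
import Data.Nat.Properties as ℕ
open import Data.Product.Base using (_×_; _,_; ∃-syntax; proj₁; proj₂)
open import Data.Product.Function.NonDependent.Propositional using (_×-↔_)
open import Data.Product.Properties using (≡-dec)
open import Data.Rational.Base as ℚ
  using (ℚ; mkℚ; 0ℚ; 1ℚ; ½; _+_; _*_; _-_; -_; ∣_∣; _≤_; _<_; 1/_; Positive)
open import Data.Rational.Properties as ℚ using (_≤?_)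
open import Data.Rational.Solver using (module +-*-Solver)
open import Data.Rational.Unnormalised.Base as ℚᵘ using (mkℚᵘ; *≡*; *≤*)
import Data.Rational.Unnormalised.Properties as ℚᵘ
open import Data.Sum.Base using (inj₁; inj₂)
open import Data.Vec.Functional as Vector using ()
open import Function.Base using (_∘_)
open import Function.Bundles using (_↔_; mk↔ₛ′; Inverse)
open import Function.Construct.Composition using (_↔-∘_)
open import Function.Construct.Symmetry using (↔-sym)
open import Function.Properties.Inverse using (↔⇒↣)
open import Relation.Binary.Definitions using (DecidableEquality)
open import Relation.Binary.PropositionalEquality
open import Relation.Nullary using (¬_; yes; no)
open import Relation.Nullary.Decidable.Core using (⌊_⌋)
open import Relation.Nullary.Negation using (contradiction)

open +-*-Solver using (solve; _:+_; _:*_; _:-_; :-_; _:=_; con)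

module RationalOrder where

  -- Stated with differences so that eq can be left to the ring solver.
  ≤-arith : ∀ {p q r s} → p ≤ q → s - r ≡ q - p → r ≤ s
  ≤-arith {p} {q} {r} {s} p≤q eq = begin
    r             ≡⟨ solve 2 (λ r p → r := (p :+ (r :- p))) refl r p ⟩
    p + (r - p)   ≤⟨ ℚ.+-monoˡ-≤ (r - p) p≤q ⟩
    q + (r - p)   ≡⟨ solve 3 (λ q r p → q :+ (r :- p) := (q :- p) :+ r) refl q r p ⟩
    (q - p) + r   ≡⟨ cong (_+ r) eq ⟨
    (s - r) + r   ≡⟨ solve 2 (λ s r → (s :- r) :+ r := s) refl s r ⟩
    s             ∎
    where open ℚ.≤-Reasoning

  p≤∣p∣ : ∀ p → p ≤ ∣ p ∣
  p≤∣p∣ p with ℚ.∣p∣≡p∨∣p∣≡-p p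
  ... | inj₁ eq = ℚ.≤-reflexive (sym eq)
  ... | inj₂ eq with ℚ.≤-total 0ℚ p
  ...   | inj₁ 0≤p = ℚ.≤-reflexive (sym (ℚ.0≤p⇒∣p∣≡p 0≤p))
  ...   | inj₂ p≤0 = ℚ.≤-trans p≤0 (ℚ.0≤∣p∣ p)

  ∣p-q∣≤ε⇒p≤q+ε : ∀ {p q ε} → ∣ p - q ∣ ≤ ε → p ≤ q + ε
  ∣p-q∣≤ε⇒p≤q+ε {p} {q} {ε} h = ≤-arith (ℚ.≤-trans (p≤∣p∣ (p - q)) h)
    (solve 3 (λ p q e → (q :+ e) :- p := e :- (p :- q)) refl p q ε)

  p≤q+ε⇒∣p-q∣≤ε : ∀ {p q ε} → p ≤ q + ε → q ≤ p + ε → ∣ p - q ∣ ≤ ε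
  p≤q+ε⇒∣p-q∣≤ε {p} {q} {ε} h₁ h₂ with ℚ.∣p∣≡p∨∣p∣≡-p (p - q)
  ... | inj₁ eq = subst (_≤ ε) (sym eq) (≤-arith h₁
    (solve 3 (λ p q e → e :- (p :- q) := (q :+ e) :- p) refl p q ε))
  ... | inj₂ eq = subst (_≤ ε) (sym eq) (≤-arith h₂
    (solve 3 (λ p q e → e :- (:- (p :- q)) := (p :+ e) :- q) refl p q ε))

  ε/2 : ℚ → ℚ
  ε/2 ε = ½ * ε

  half+half : ∀ ε → ε/2 ε + ε/2 ε ≡ ε
  half+half = solve 1 (λ e → con ½ :* e :+ con ½ :* e := e) refl

  half-pos : ∀ ε .{{_ : Positive ε}} → Positive (ε/2 ε)
  half-pos ε = ℚ.pos*pos⇒pos ½ ε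

  *-mono-≤ : ∀ {p q r s} → 0ℚ ≤ p → p ≤ q → 0ℚ ≤ r → r ≤ s → p * r ≤ q * s
  *-mono-≤ {p} {q} {r} {s} 0≤p p≤q 0≤r r≤s = ℚ.≤-trans
    (ℚ.*-monoʳ-≤-nonNeg r {{ℚ.nonNegative 0≤r}} p≤q)
    (ℚ.*-monoˡ-≤-nonNeg q {{ℚ.nonNegative (ℚ.≤-trans 0≤p p≤q)}} r≤s)

  0≤p+q : ∀ {p q} → 0ℚ ≤ p → 0ℚ ≤ q → 0ℚ ≤ p + q
  0≤p+q = ℚ.+-mono-≤

  0≤p*q : ∀ {p q} → 0ℚ ≤ p → 0ℚ ≤ q → 0ℚ ≤ p * q
  0≤p*q {p} {q} 0≤p 0≤q =
    *-mono-≤ (ℚ.≤-refl {0ℚ}) 0≤p (ℚ.≤-refl {0ℚ}) 0≤q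

open RationalOrder

IsCauchy : (ℕ → ℚ) → Set
IsCauchy s = ∀ ε .{{_ : Positive ε}} →
             ∃[ N ] (∀ m n → N ℕ.≤ m → N ℕ.≤ n → ∣ s m - s n ∣ ≤ ε)

-- Cauchy sequences of rationals with a modulus; equality of reals is _≃ᵣ_.
record ℝ : Set where
  constructor mkℝ
  field
    seq    : ℕ → ℚ
    cauchy : IsCauchy seq

open ℝ public

infix 4 _≃ᵣ_ _≤ᵣ_

_≃ᵣ_ : ℝ → ℝ → Set
x ≃ᵣ y = ∀ ε .{{_ : Positive ε}} →
         ∃[ N ] (∀ n → N ℕ.≤ n → ∣ seq x n - seq y n ∣ ≤ ε)

_≤ᵣ_ : ℝ → ℝ → Set
x ≤ᵣ y = ∀ ε .{{_ : Positive ε}} →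
         ∃[ N ] (∀ n → N ℕ.≤ n → seq x n ≤ seq y n + ε)

abstract
  const-cauchy : ∀ q → IsCauchy (λ _ → q)
  const-cauchy q ε = 0 , λ _ _ _ _ →
    subst (λ p → ∣ p ∣ ≤ ε) (sym (ℚ.+-inverseʳ q)) (ℚ.<⇒≤ (ℚ.positive⁻¹ ε))

fromℚ : ℚ → ℝ
fromℚ q = mkℝ (λ _ → q) (const-cauchy q)

0ᵣ 1ᵣ : ℝ
0ᵣ = fromℚ 0ℚ
1ᵣ = fromℚ 1ℚ

infixl 6 _+ᵣ_
infixl 7 _*ᵣ_

abstract
  +-cauchy : ∀ x y → IsCauchy (λ n → seq x n + seq y n)
  +-cauchy x y ε =
    let N , hx = cauchy x (ε/2 ε) {{half-pos ε}}
        M , hy = cauchy y (ε/2 ε) {{half-pos ε}}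
    in N ⊔ M , λ m n N≤m N≤n → begin
      ∣ (seq x m + seq y m) - (seq x n + seq y n) ∣
        ≡⟨ cong ∣_∣ (solve 4 (λ a b c d → (a :+ b) :- (c :+ d) := (a :- c) :+ (b :- d))
                      refl (seq x m) (seq y m) (seq x n) (seq y n)) ⟩
      ∣ (seq x m - seq x n) + (seq y m - seq y n) ∣
        ≤⟨ ℚ.∣p+q∣≤∣p∣+∣q∣ (seq x m - seq x n) (seq y m - seq y n) ⟩
      ∣ seq x m - seq x n ∣ + ∣ seq y m - seq y n ∣
        ≤⟨ ℚ.+-mono-≤ (hx m n (ℕ.m⊔n≤o⇒m≤o N M N≤m) (ℕ.m⊔n≤o⇒m≤o N M N≤n))
                      (hy m n (ℕ.m⊔n≤o⇒n≤o N M N≤m) (ℕ.m⊔n≤o⇒n≤o N M N≤n)) ⟩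
      ε/2 ε + ε/2 ε
        ≡⟨ half+half ε ⟩
      ε ∎
    where open ℚ.≤-Reasoning

_+ᵣ_ : ℝ → ℝ → ℝ
x +ᵣ y = mkℝ (λ n → seq x n + seq y n) (+-cauchy x y)

module Bounds where

  abstract
    bounded : ∀ x → ∃[ B ] Positive B × ∃[ N ] (∀ n → N ℕ.≤ n → ∣ seq x n ∣ ≤ B)
    bounded x =
      let N , h = cauchy x 1ℚ
          b     = ∣ seq x N ∣
      in b + 1ℚ
       , ℚ.nonNeg+pos⇒pos b {{ℚ.∣-∣-nonNeg (seq x N)}} 1ℚ
       , N
       , λ n N≤n → begin
           ∣ seq x n ∣
             ≡⟨ cong ∣_∣ (solve 2 (λ a b → a := b :+ (a :- b)) refl (seq x n) (seq x N)) ⟩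
           ∣ seq x N + (seq x n - seq x N) ∣
             ≤⟨ ℚ.∣p+q∣≤∣p∣+∣q∣ (seq x N) (seq x n - seq x N) ⟩
           ∣ seq x N ∣ + ∣ seq x n - seq x N ∣
             ≤⟨ ℚ.+-monoʳ-≤ ∣ seq x N ∣ (h n N N≤n ℕ.≤-refl) ⟩
           ∣ seq x N ∣ + 1ℚ ∎
      where open ℚ.≤-Reasoning

    quotient : ∀ ε B → .{{_ : Positive ε}} → Positive B →
               ∃[ δ ] Positive δ × B * δ ≡ ε
    quotient ε B B>0 = ε * B⁻¹ , ℚ.pos*pos⇒pos ε B⁻¹ , (begin
      B * (ε * B⁻¹)   ≡⟨ solve 3 (λ b e c → b :* (e :* c) := e :* (b :* c)) refl B ε B⁻¹ ⟩
      ε * (B * B⁻¹)   ≡⟨ cong (ε *_) (ℚ.*-inverseʳ B) ⟩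
      ε * 1ℚ          ≡⟨ ℚ.*-identityʳ ε ⟩
      ε               ∎)
      where
      open ≡-Reasoning
      instance
        B-pos : Positive B
        B-pos = B>0
        B≢0 : ℚ.NonZero B
        B≢0 = ℚ.pos⇒nonZero B
      B⁻¹ : ℚ
      B⁻¹ = 1/ B
      instance
        B⁻¹>0 : Positive B⁻¹
        B⁻¹>0 = ℚ.1/pos⇒pos B

open Bounds

abstract
  *-cauchy : ∀ x y → IsCauchy (λ n → seq x n * seq y n)
  *-cauchy x y ε =
    let A , A>0 , K , hA = bounded x
        B , B>0 , L , hB = bounded y
        δ , δ>0 , eq     = quotient ε (A + B) (ℚ.pos+pos⇒pos A {{A>0}} B {{B>0}})
        N , hx           = cauchy x δ {{δ>0}}
        M , hy           = cauchy y δ {{δ>0}}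
    in (K ⊔ L) ⊔ (N ⊔ M) , λ m n N≤m N≤n →
      let KL≤m = ℕ.m⊔n≤o⇒m≤o (K ⊔ L) (N ⊔ M) N≤m
          KL≤n = ℕ.m⊔n≤o⇒m≤o (K ⊔ L) (N ⊔ M) N≤n
          NM≤m = ℕ.m⊔n≤o⇒n≤o (K ⊔ L) (N ⊔ M) N≤m
          NM≤n = ℕ.m⊔n≤o⇒n≤o (K ⊔ L) (N ⊔ M) N≤n
          a = seq x m; b = seq y m; c = seq x n; d = seq y n
      in begin
        ∣ a * b - c * d ∣
          ≡⟨ cong ∣_∣ (solve 4 (λ a b c d → a :* b :- c :* d := a :* (b :- d) :+ d :* (a :- c))
                        refl a b c d) ⟩
        ∣ a * (b - d) + d * (a - c) ∣
          ≤⟨ ℚ.∣p+q∣≤∣p∣+∣q∣ (a * (b - d)) (d * (a - c)) ⟩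
        ∣ a * (b - d) ∣ + ∣ d * (a - c) ∣
          ≡⟨ cong₂ _+_ (ℚ.∣p*q∣≡∣p∣*∣q∣ a (b - d)) (ℚ.∣p*q∣≡∣p∣*∣q∣ d (a - c)) ⟩
        ∣ a ∣ * ∣ b - d ∣ + ∣ d ∣ * ∣ a - c ∣
          ≤⟨ ℚ.+-mono-≤
               (*-mono-≤ (ℚ.0≤∣p∣ a) (hA m (ℕ.m⊔n≤o⇒m≤o K L KL≤m)) (ℚ.0≤∣p∣ (b - d))
                 (hy m n (ℕ.m⊔n≤o⇒n≤o N M NM≤m) (ℕ.m⊔n≤o⇒n≤o N M NM≤n)))
               (*-mono-≤ (ℚ.0≤∣p∣ d) (hB n (ℕ.m⊔n≤o⇒n≤o K L KL≤n)) (ℚ.0≤∣p∣ (a - c))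
                 (hx m n (ℕ.m⊔n≤o⇒m≤o N M NM≤m) (ℕ.m⊔n≤o⇒m≤o N M NM≤n))) ⟩
        A * δ + B * δ
          ≡⟨ ℚ.*-distribʳ-+ δ A B ⟨
        (A + B) * δ
          ≡⟨ eq ⟩
        ε ∎
    where open ℚ.≤-Reasoning

_*ᵣ_ : ℝ → ℝ → ℝ
x *ᵣ y = mkℝ (λ n → seq x n * seq y n) (*-cauchy x y)

½^ : ℕ → ℚ
½^ zero    = 1ℚ
½^ (suc n) = ½ * ½^ n

-- The lower end of the n-th bisection interval for the square root of
-- q ≥ 0, starting from [ 0 , 1 + q ]; the interval has width (1 + q) / 2ⁿ.
bisect : ℚ → ℕ → ℚ
bisect q zero    = 0ℚ
bisect q (suc n) =
  let mid = bisect q n + (1ℚ + q) * ½^ (suc n)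
  in if ⌊ mid * mid ≤? q ⌋ then mid else bisect q n

module Bisection where

  width : ℚ → ℕ → ℚ
  width q n = (1ℚ + q) * ½^ n

  0≤½^ : ∀ n → 0ℚ ≤ ½^ n
  0≤½^ zero    = ℚ.nonNegative⁻¹ 1ℚ
  0≤½^ (suc n) = 0≤p*q (ℚ.nonNegative⁻¹ ½) (0≤½^ n)

  ½^-anti : ∀ n → ½^ (suc n) ≤ ½^ n
  ½^-anti n = ≤-arith (0≤½^ (suc n))
    (solve 1 (λ h → h :- con ½ :* h := con ½ :* h :- con 0ℚ) refl (½^ n))

  ½^-mono : ∀ {m n} → m ℕ.≤′ n → ½^ n ≤ ½^ m
  ½^-mono (ℕ.≤′-reflexive refl)   = ℚ.≤-refl
  ½^-mono (ℕ.≤′-step {n} m≤n) = ℚ.≤-trans (½^-anti n) (½^-mono m≤n)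

  toℚ : ℕ → ℚ
  toℚ zero    = 0ℚ
  toℚ (suc n) = 1ℚ + toℚ n

  0≤toℚ : ∀ n → 0ℚ ≤ toℚ n
  0≤toℚ zero    = ℚ.≤-refl
  0≤toℚ (suc n) = 0≤p+q (ℚ.nonNegative⁻¹ 1ℚ) (0≤toℚ n)

  -- Bernoulli: (1 + n) / 2ⁿ ≤ 1
  ½^-bernoulli : ∀ n → ½^ n * toℚ (suc n) ≤ 1ℚ
  ½^-bernoulli zero    = ℚ.≤-refl
  ½^-bernoulli (suc n) = ℚ.≤-trans (≤-arith (0≤p*q (0≤½^ (suc n)) (0≤toℚ n))
    (solve 2 (λ h t → h :* (con 1ℚ :+ t) :- (con ½ :* h) :* (con 1ℚ :+ (con 1ℚ :+ t))
                    := (con ½ :* h) :* t :- con 0ℚ) refl (½^ n) (toℚ n)))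
    (½^-bernoulli n)

  toℚ≡/1 : ∀ n → toℚ n ≡ ℤ.+ n ℚ./ 1
  toℚ≡/1 zero    = refl
  toℚ≡/1 (suc n) = trans (cong (1ℚ +_) (toℚ≡/1 n)) (ℚ.toℚᵘ-injective (begin
    ℚ.toℚᵘ (1ℚ + ℤ.+ n ℚ./ 1)            ≈⟨ ℚ.toℚᵘ-homo-+ 1ℚ (ℤ.+ n ℚ./ 1) ⟩
    ℚ.toℚᵘ 1ℚ ℚᵘ.+ ℚ.toℚᵘ (ℤ.+ n ℚ./ 1)  ≈⟨ ℚᵘ.+-congʳ (ℚ.toℚᵘ 1ℚ) (ℚ.toℚᵘ-fromℚᵘ (mkℚᵘ (ℤ.+ n) 0)) ⟩
    ℚ.toℚᵘ 1ℚ ℚᵘ.+ mkℚᵘ (ℤ.+ n) 0        ≈⟨ *≡* (cong (ℤ._* ℤ.+ 1) (cong (ℤ._+_ (ℤ.+ 1)) (ℤ.*-identityʳ (ℤ.+ n)))) ⟩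
    mkℚᵘ (ℤ.+ suc n) 0                    ≈⟨ ℚ.toℚᵘ-fromℚᵘ (mkℚᵘ (ℤ.+ suc n) 0) ⟨
    ℚ.toℚᵘ (ℤ.+ suc n ℚ./ 1)              ∎))
    where open ℚᵘ.≃-Reasoning

  -- Every positive rational is at least the reciprocal of its denominator.
  1≤ε*↧ε : ∀ ε .{{_ : Positive ε}} → 1ℚ ≤ toℚ (suc (ℚ.denominator-1 ε)) * ε
  1≤ε*↧ε ε@(mkℚ ℤ.+[1+ a ] d c) = subst (λ t → 1ℚ ≤ t * ε) (sym (toℚ≡/1 (suc d)))
    (ℚ.toℚᵘ-cancel-≤ (begin
      ℚ.toℚᵘ 1ℚ                              ≤⟨ *≤* (ℤ.+≤+ lemma) ⟩
      mkℚᵘ (ℤ.+ suc d) 0 ℚᵘ.* ℚ.toℚᵘ ε         ≃⟨ ℚᵘ.*-congʳ {ℚ.toℚᵘ ε} (ℚ.toℚᵘ-fromℚᵘ (mkℚᵘ (ℤ.+ suc d) 0)) ⟨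
      ℚ.toℚᵘ (ℤ.+ suc d ℚ./ 1) ℚᵘ.* ℚ.toℚᵘ ε   ≃⟨ ℚ.toℚᵘ-homo-* (ℤ.+ suc d ℚ./ 1) ε ⟨
      ℚ.toℚᵘ ((ℤ.+ suc d ℚ./ 1) * ε)           ∎))
    where
    open ℚᵘ.≤-Reasoning
    lemma : 1 ℕ.* (1 ℕ.* suc d) ℕ.≤ suc d ℕ.* suc a ℕ.* 1
    lemma = subst₂ ℕ._≤_
      (sym (trans (ℕ.*-identityˡ (1 ℕ.* suc d)) (ℕ.*-identityˡ (suc d))))
      (sym (ℕ.*-identityʳ (suc d ℕ.* suc a)))
      (ℕ.m≤m*n (suc d) (suc a))

  ½^-small : ∀ ε .{{_ : Positive ε}} → ∃[ N ] (∀ n → N ℕ.≤ n → ½^ n ≤ ε)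
  ½^-small ε = N , λ n N≤n → ℚ.≤-trans (½^-mono (ℕ.≤⇒≤′ N≤n)) (begin
    ½^ N                        ≡⟨ ℚ.*-identityʳ (½^ N) ⟨
    ½^ N * 1ℚ                   ≤⟨ ℚ.*-monoˡ-≤-nonNeg (½^ N) {{ℚ.nonNegative (0≤½^ N)}} (1≤ε*↧ε ε) ⟩
    ½^ N * (toℚ (suc N) * ε)    ≡⟨ ℚ.*-assoc (½^ N) (toℚ (suc N)) ε ⟨
    (½^ N * toℚ (suc N)) * ε    ≤⟨ ℚ.*-monoʳ-≤-nonNeg ε {{ℚ.pos⇒nonNeg ε}} (½^-bernoulli N) ⟩
    1ℚ * ε                      ≡⟨ ℚ.*-identityˡ ε ⟩
    ε                           ∎)
    where
    open ℚ.≤-Reasoning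
    N : ℕ
    N = ℚ.denominator-1 ε

  0≤width : ∀ {q} → 0ℚ ≤ q → ∀ n → 0ℚ ≤ width q n
  0≤width 0≤q n = 0≤p*q (0≤p+q (ℚ.nonNegative⁻¹ 1ℚ) 0≤q) (0≤½^ n)

  0≤bisect : ∀ {q} → 0ℚ ≤ q → ∀ n → 0ℚ ≤ bisect q n
  0≤bisect 0≤q zero = ℚ.≤-refl
  0≤bisect {q} 0≤q (suc n)
    with (bisect q n + width q (suc n)) * (bisect q n + width q (suc n)) ≤? q
  ... | yes _ = 0≤p+q (0≤bisect 0≤q n) (0≤width 0≤q (suc n))
  ... | no  _ = 0≤bisect 0≤q n

  bisect²≤ : ∀ {q} → 0ℚ ≤ q → ∀ n → bisect q n * bisect q n ≤ q
  bisect²≤ 0≤q zero = 0≤q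
  bisect²≤ {q} 0≤q (suc n)
    with (bisect q n + width q (suc n)) * (bisect q n + width q (suc n)) ≤? q
  ... | yes h = h
  ... | no  _ = bisect²≤ 0≤q n

  ≤bisect² : ∀ {q} → 0ℚ ≤ q → ∀ n →
             q ≤ (bisect q n + width q n) * (bisect q n + width q n)
  ≤bisect² {q} 0≤q zero =
    ≤-arith (0≤p+q (ℚ.nonNegative⁻¹ 1ℚ) (0≤p+q 0≤q (0≤p*q 0≤q 0≤q)))
      (solve 1 (λ q → let w = con 0ℚ :+ (con 1ℚ :+ q) :* con 1ℚ in
                w :* w :- q := (con 1ℚ :+ (q :+ q :* q)) :- con 0ℚ) refl q)
  ≤bisect² {q} 0≤q (suc n)
    with (bisect q n + width q (suc n)) * (bisect q n + width q (suc n)) ≤? q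
  ... | yes _ = subst (q ≤_)
    (solve 3 (λ b q h → let w = (con 1ℚ :+ q) :* h
                            w′ = (con 1ℚ :+ q) :* (con ½ :* h) in
              (b :+ w) :* (b :+ w) := ((b :+ w′) :+ w′) :* ((b :+ w′) :+ w′))
      refl (bisect q n) q (½^ n))
    (≤bisect² 0≤q n)
  ... | no ¬h = ℚ.<⇒≤ (ℚ.≰⇒> ¬h)

  ≤bisect²+ : ∀ B δ {q} → 0ℚ ≤ q → ∀ n → bisect q n ≤ B → width q n ≤ δ → width q n ≤ 1ℚ →
              q ≤ bisect q n * bisect q n + (B + B + 1ℚ) * δ
  ≤bisect²+ B δ {q} 0≤q n s≤B w≤δ w≤1 = begin
    q
      ≤⟨ ≤bisect² 0≤q n ⟩
    (s + w) * (s + w)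
      ≡⟨ solve 2 (λ s w → (s :+ w) :* (s :+ w) := s :* s :+ (s :+ s :+ w) :* w) refl s w ⟩
    s * s + (s + s + w) * w
      ≤⟨ ℚ.+-monoʳ-≤ (s * s) (*-mono-≤ (0≤p+q (0≤p+q 0≤s 0≤s) 0≤w)
           (ℚ.+-mono-≤ (ℚ.+-mono-≤ s≤B s≤B) w≤1) 0≤w w≤δ) ⟩
    s * s + (B + B + 1ℚ) * δ ∎
    where
    open ℚ.≤-Reasoning
    s w : ℚ
    s = bisect q n
    w = width q n
    0≤s : 0ℚ ≤ s
    0≤s = 0≤bisect 0≤q n
    0≤w : 0ℚ ≤ w
    0≤w = 0≤width 0≤q n

  _⁺ : ℚ → ℚ
  q ⁺ = q ℚ.⊔ 0ℚ

  0≤⁺ : ∀ q → 0ℚ ≤ q ⁺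
  0≤⁺ q = ℚ.p≤q⊔p q 0ℚ

  ⁺-lipschitz : ∀ {p q δ} → 0ℚ ≤ δ → p ≤ q + δ → p ⁺ ≤ q ⁺ + δ
  ⁺-lipschitz {p} {q} {δ} 0≤δ h = ℚ.⊔-lub
    (ℚ.≤-trans h (ℚ.+-monoˡ-≤ δ (ℚ.p≤p⊔q q 0ℚ)))
    (0≤p+q (0≤⁺ q) 0≤δ)

  ⁺≤∣∣ : ∀ q → q ⁺ ≤ ∣ q ∣
  ⁺≤∣∣ q = ℚ.⊔-lub (p≤∣p∣ q) (ℚ.0≤∣p∣ q)

  abstract
    width-small : ∀ x ε .{{_ : Positive ε}} →
                  ∃[ N ] (∀ n → N ℕ.≤ n → width (seq x n ⁺) n ≤ ε)
    width-small x ε =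
      let B , B>0 , K , hB = bounded x
          δ , δ>0 , eq     = quotient ε (1ℚ + B) (ℚ.pos+pos⇒pos 1ℚ B {{B>0}})
          N , h            = ½^-small δ {{δ>0}}
      in K ⊔ N , λ n le → begin
        (1ℚ + seq x n ⁺) * ½^ n
          ≤⟨ *-mono-≤ (0≤p+q (ℚ.nonNegative⁻¹ 1ℚ) (0≤⁺ (seq x n)))
               (ℚ.+-monoʳ-≤ 1ℚ (ℚ.≤-trans (⁺≤∣∣ (seq x n)) (hB n (ℕ.m⊔n≤o⇒m≤o K N le))))
               (0≤½^ n) (h n (ℕ.m⊔n≤o⇒n≤o K N le)) ⟩
        (1ℚ + B) * δ
          ≡⟨ eq ⟩
        ε ∎
      where open ℚ.≤-Reasoning

  -- If s² ≤ (t + ε/2)² + (ε/2)², then s ≤ t + ε.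
  root-lemma : ∀ {s t w} ε .{{_ : Positive ε}} → 0ℚ ≤ t → 0ℚ ≤ w → w ≤ ε/2 ε →
               s * s ≤ (t + w) * (t + w) + ε/2 ε * ε/2 ε → s ≤ t + ε
  root-lemma {s} {t} {w} ε 0≤t 0≤w w≤ h with s ≤? t + ε
  ... | yes p = p
  ... | no ¬p = contradiction s²<s² (ℚ.<-irrefl refl)
    where
    open ℚ.≤-Reasoning
    e : ℚ
    e = ε/2 ε
    instance
      e>0 : Positive e
      e>0 = half-pos ε
      e²>0 : Positive (e * e)
      e²>0 = ℚ.pos*pos⇒pos e e
    0≤ε : 0ℚ ≤ ε
    0≤ε = ℚ.<⇒≤ (ℚ.positive⁻¹ ε)
    0≤e : 0ℚ ≤ e
    0≤e = ℚ.<⇒≤ (ℚ.positive⁻¹ e)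
    te<s : t + ε ≤ s
    te<s = ℚ.<⇒≤ (ℚ.≰⇒> ¬p)
    s²<s² : s * s < s * s
    s²<s² = begin-strict
      s * s
        ≤⟨ h ⟩
      (t + w) * (t + w) + e * e
        ≤⟨ ℚ.+-monoˡ-≤ (e * e) (*-mono-≤ (0≤p+q 0≤t 0≤w) (ℚ.+-monoʳ-≤ t w≤)
                                          (0≤p+q 0≤t 0≤w) (ℚ.+-monoʳ-≤ t w≤)) ⟩
      (t + e) * (t + e) + e * e
        ≡⟨ ℚ.+-identityʳ _ ⟨
      (t + e) * (t + e) + e * e + 0ℚ
        <⟨ ℚ.+-monoʳ-< ((t + e) * (t + e) + e * e) (ℚ.positive⁻¹ (e * e)) ⟩
      (t + e) * (t + e) + e * e + e * e
        ≤⟨ ≤-arith (0≤p+q (0≤p*q 0≤t 0≤ε) (0≤p*q 0≤e 0≤e))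
             (solve 2 (λ t ε → let e = con ½ :* ε in
                (t :+ ε) :* (t :+ ε) :- ((t :+ e) :* (t :+ e) :+ e :* e :+ e :* e)
                := (t :* ε :+ e :* e) :- con 0ℚ) refl t ε) ⟩
      (t + ε) * (t + ε)
        ≤⟨ *-mono-≤ (0≤p+q 0≤t 0≤ε) te<s (0≤p+q 0≤t 0≤ε) te<s ⟩
      s * s ∎

open Bisection

abstract
  √-cauchy : ∀ x → IsCauchy (λ n → bisect (seq x n ⁺) n)
  √-cauchy x ε =
    let e     = ε/2 ε
        e>0   = half-pos ε
        e²>0  = ℚ.pos*pos⇒pos e {{e>0}} e {{e>0}}
        N , h = cauchy x (e * e) {{e²>0}}
        M , w = width-small x e {{e>0}}
        0≤e²  = ℚ.<⇒≤ (ℚ.positive⁻¹ (e * e) {{e²>0}})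
        one : ∀ m n → N ⊔ M ℕ.≤ m → N ⊔ M ℕ.≤ n →
              bisect (seq x m ⁺) m ≤ bisect (seq x n ⁺) n + ε
        one m n ≤m ≤n = root-lemma ε
          (0≤bisect (0≤⁺ (seq x n)) n)
          (0≤width (0≤⁺ (seq x n)) n)
          (w n (ℕ.m⊔n≤o⇒n≤o N M ≤n))
          (ℚ.≤-trans (bisect²≤ (0≤⁺ (seq x m)) m)
          (ℚ.≤-trans (⁺-lipschitz {seq x m} {seq x n} 0≤e² (∣p-q∣≤ε⇒p≤q+ε
                       (h m n (ℕ.m⊔n≤o⇒m≤o N M ≤m) (ℕ.m⊔n≤o⇒m≤o N M ≤n))))
                     (ℚ.+-monoˡ-≤ (e * e) (≤bisect² (0≤⁺ (seq x n)) n))))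
    in N ⊔ M , λ m n ≤m ≤n → p≤q+ε⇒∣p-q∣≤ε (one m n ≤m ≤n) (one n m ≤n ≤m)

-- The square root of x for x ≥ 0; negative terms are replaced by 0, so
-- that √ is total (and is 0 at negative arguments).
√ : ℝ → ℝ
√ x = mkℝ (λ n → bisect (seq x n ⁺) n) (√-cauchy x)

√-nonNeg : ∀ x → 0ᵣ ≤ᵣ √ x
√-nonNeg x ε = 0 , λ n _ →
  0≤p+q (0≤bisect (0≤⁺ (seq x n)) n) (ℚ.<⇒≤ (ℚ.positive⁻¹ ε))

√-square : ∀ x → 0ᵣ ≤ᵣ x → √ x *ᵣ √ x ≃ᵣ x
√-square x 0≤x ε =
  let B , B>0 , bound = bounded (√ x)
      C>0             = ℚ.pos+pos⇒pos (B + B) {{ℚ.pos+pos⇒pos B {{B>0}} B {{B>0}}}} 1ℚ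
      δ , δ>0 , eq    = quotient ε (B + B + 1ℚ) C>0
  in close B δ eq bound (0≤x ε) (width-small x δ {{δ>0}}) (width-small x 1ℚ)
  where
  s : ℕ → ℚ
  s n = bisect (seq x n ⁺) n

  p≤p+ε : ∀ p → p ≤ p + ε
  p≤p+ε p = ≤-arith (ℚ.<⇒≤ (ℚ.positive⁻¹ ε))
    (solve 2 (λ p e → (p :+ e) :- p := e :- con 0ℚ) refl p ε)

  Eventually : (ℕ → Set) → Set
  Eventually P = ∃[ N ] (∀ n → N ℕ.≤ n → P n)

  close : ∀ B δ → (B + B + 1ℚ) * δ ≡ ε →
          Eventually (λ n → ∣ s n ∣ ≤ B) →
          Eventually (λ n → 0ℚ ≤ seq x n + ε) →
          Eventually (λ n → width (seq x n ⁺) n ≤ δ) →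
          Eventually (λ n → width (seq x n ⁺) n ≤ 1ℚ) →
          Eventually (λ n → ∣ s n * s n - seq x n ∣ ≤ ε)
  close B δ eq (K , hB) (N , h₀) (M , hδ) (L , h₁) = (K ⊔ N) ⊔ (M ⊔ L) , λ n le →
    let KN  = ℕ.m⊔n≤o⇒m≤o (K ⊔ N) (M ⊔ L) le
        ML  = ℕ.m⊔n≤o⇒n≤o (K ⊔ N) (M ⊔ L) le
        0≤q = 0≤⁺ (seq x n)
    in p≤q+ε⇒∣p-q∣≤ε {s n * s n} {seq x n}
      (ℚ.≤-trans (bisect²≤ 0≤q n)
        (ℚ.⊔-lub (p≤p+ε (seq x n)) (h₀ n (ℕ.m⊔n≤o⇒n≤o K N KN))))
      (ℚ.≤-trans (ℚ.p≤p⊔q (seq x n) 0ℚ)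
        (subst (λ t → seq x n ⁺ ≤ s n * s n + t) eq
          (≤bisect²+ B δ 0≤q n
            (ℚ.≤-trans (p≤∣p∣ (s n)) (hB n (ℕ.m⊔n≤o⇒m≤o K N KN)))
            (hδ n (ℕ.m⊔n≤o⇒m≤o M L ML))
            (h₁ n (ℕ.m⊔n≤o⇒n≤o M L ML)))))

-- A finite set with a fixed bijection to Fin size, size positive.
record FinSet : Set₁ where
  field
    Carrier      : Set
    size         : ℕ
    enum         : Carrier ↔ Fin size
    {{nonEmpty}} : NonZero size

  _≟_ : DecidableEquality Carrier
  _≟_ = inj⇒≟ (↔⇒↣ enum)

  elements : List Carrier
  elements = List.map (Inverse.from enum) (List.allFin size)

open FinSet using (Carrier; size; enum; elements)

infixr 2 _⊗_

_⊗_ : FinSet → FinSet → FinSet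
A ⊗ B = record
  { Carrier  = Carrier A × Carrier B
  ; size     = size A ℕ.* size B
  ; enum     = ↔-sym *↔× ↔-∘ (enum A ×-↔ enum B)
  ; nonEmpty = ℕ.m*n≢0 (size A) (size B) {{FinSet.nonEmpty A}} {{FinSet.nonEmpty B}}
  }

Σᵣ : (A : FinSet) → (Carrier A → ℝ) → ℝ
Σᵣ A f = Vector.foldr _+ᵣ_ 0ᵣ (f ∘ Inverse.from (enum A))

record Graph (V L : FinSet) : Set where
  field
    Rot        : Carrier V × Carrier L → Carrier V × Carrier L
    involutive : ∀ x → Rot (Rot x) ≡ x

open Graph public

relabel : ∀ {V L L′} → Carrier L ↔ Carrier L′ → Graph V L → Graph V L′
relabel {V} {L} {L′} φ G = record { Rot = rot ; involutive = inv }
  where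
  open Inverse φ
  rot : Carrier V × Carrier L′ → Carrier V × Carrier L′
  rot (v , i) = let w , j = Rot G (v , from i) in w , to j
  inv : ∀ x → rot (rot x) ≡ x
  inv (v , i)
    rewrite strictlyInverseʳ (proj₂ (Rot G (v , from i)))
          | involutive G (v , from i)
          | strictlyInverseˡ i = refl

square : ∀ {V L} → Graph V L → Graph V (L ⊗ L)
square {V} {L} G = record { Rot = rot ; involutive = inv }
  where
  rot : Carrier V × Carrier (L ⊗ L) → Carrier V × Carrier (L ⊗ L)
  rot (v₀ , (k₁ , k₂)) =
    let v₁ , ℓ₁ = Rot G (v₀ , k₁)
        v₂ , ℓ₂ = Rot G (v₁ , k₂)
    in v₂ , (ℓ₂ , ℓ₁)
  inv : ∀ x → rot (rot x) ≡ x
  inv (v₀ , (k₁ , k₂))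
    rewrite involutive G (proj₁ (Rot G (v₀ , k₁)) , k₂)
          | involutive G (v₀ , k₁) = refl

-- The first argument is the large graph, the second the small one.
zigzag : ∀ {V₁ L₁ L₂} → Graph V₁ L₁ → Graph L₁ L₂ → Graph (V₁ ⊗ L₁) (L₂ ⊗ L₂)
zigzag {V₁} {L₁} {L₂} G₁ G₂ = record { Rot = rot ; involutive = inv }
  where
  rot : Carrier (V₁ ⊗ L₁) × Carrier (L₂ ⊗ L₂) → Carrier (V₁ ⊗ L₁) × Carrier (L₂ ⊗ L₂)
  rot ((v , k) , (i , j)) =
    let k′ , i′ = Rot G₂ (k , i)
        w  , ℓ′ = Rot G₁ (v , k′)
        ℓ  , j′ = Rot G₂ (ℓ′ , j)
    in (w , ℓ) , (j′ , i′)
  inv : ∀ x → rot (rot x) ≡ x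
  inv ((v , k) , (i , j))
    rewrite involutive G₂ (proj₂ (Rot G₁ (v , proj₁ (Rot G₂ (k , i)))) , j)
          | involutive G₁ (v , proj₁ (Rot G₂ (k , i)))
          | involutive G₂ (k , i) = refl

module _ {V L : FinSet} where

  opaque
    -- The number of pairs (i , j) with Rot (u , i) ≡ (v , j);
    -- opaque only because its normal form is very large.
    edges : Graph V L → Carrier V → Carrier V → ℕ
    edges G u v = length (filter
      (λ (i , j) → ≡-dec (FinSet._≟_ V) (FinSet._≟_ L) (Rot G (u , i)) (v , j))
      (cartesianProduct (elements L) (elements L)))

  adjacency : Graph V L → Carrier V → Carrier V → ℝ
  adjacency G u v = fromℚ (ℚ._/_ (ℤ.+ edges G u v) (size L) {{FinSet.nonEmpty L}})

module Euclidean (V : FinSet) where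

  infix 4 _⊥_

  Vec : Set
  Vec = Carrier V → ℝ

  ⟨_,_⟩ : Vec → Vec → ℝ
  ⟨ α , β ⟩ = Σᵣ V λ v → α v *ᵣ β v

  _⊥_ : Vec → Vec → Set
  α ⊥ β = ⟨ α , β ⟩ ≃ᵣ 0ᵣ

  ‖_‖ : Vec → ℝ
  ‖ α ‖ = √ ⟨ α , α ⟩

  𝟙 : Vec
  𝟙 _ = 1ᵣ

  𝟘 : Vec
  𝟘 _ = 0ᵣ

  apply : (Carrier V → Carrier V → ℝ) → Vec → Vec
  apply M α u = Σᵣ V λ v → M u v *ᵣ α v

-- λ(G) ≤ c: every ratio ‖Mα‖ / ‖α‖ with α ⊥ 𝟙 and α ≠ 0 is at most c, so
-- that the maximum λ(G) of these ratios is.  The conjunct 0 ≤ c is implied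
-- by the other when there are at least two vertices; with one vertex there is
-- no such α, and the conjunct states the bound for λ(G) = 0.
SecondEigenvalue≤ : ∀ {V L} → Graph V L → ℝ → Set
SecondEigenvalue≤ {V} G c =
  0ᵣ ≤ᵣ c ×
  ((α : Vec) → α ⊥ 𝟙 → ¬ (∀ v → α v ≃ᵣ 𝟘 v) →
    ‖ apply (adjacency G) α ‖ ≤ᵣ c *ᵣ ‖ α ‖)
  where open Euclidean V

-- G is an (N,D,c)-graph.
record IsGraph {V L : FinSet} (G : Graph V L) (N D : ℕ) (c : ℝ) : Set where
  field
    vertices : size V ≡ N
    degree   : size L ≡ D
    bound    : SecondEigenvalue≤ G c

-- φ identifies the edge labels of the square of each graph in the sequence
-- with the vertices of H.
module Iteration {V K : FinSet} (H : Graph V K)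
                 (φ : Carrier ((K ⊗ K) ⊗ (K ⊗ K)) ↔ Carrier V) where

  vertexSet : ∀ i .{{_ : NonZero i}} → FinSet
  vertexSet 1             = V
  vertexSet (suc (suc i)) = vertexSet (suc i) ⊗ V

  graph : ∀ i .{{_ : NonZero i}} → Graph (vertexSet i) (K ⊗ K)
  graph 1             = square H
  graph (suc (suc i)) = zigzag (relabel φ (square (graph (suc i)))) H

{-# OPTIONS --safe #-}

-- Every graph is replaced by its walk operator on rational functions,
-- (walk G a) v = the average of a over the neighbours of v, which is
-- self-adjoint for ⟨ f , g ⟩ = 𝔼 (f g).  A bound on the quadratic form
-- ∣ ⟨ walk a , a ⟩ ∣ ≤ c ‖ a ‖² on mean-zero functions implies the norm bound
-- ‖ walk a ‖ ≤ c ‖ a ‖ by polarization, and a norm bound c for G gives the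
-- form bound c² for its square.  For the zig-zag product the form is
-- ⟨ b ∘ Rot , b ⟩ with b the fibrewise H-average of a; splitting a into its
-- fibre means and a remainder gives the bound λ₁ + λ₂ + λ₂², and
-- 4/25 + 1/5 + 1/25 = 2/5.
-- A Cauchy sequence of vectors is a sequence of rational vectors, so the
-- bounds pass between rational and real vectors termwise: the means tend to 0,
-- and a nonzero mean m contributes only m² to ‖ walk a ‖².

module Submission where

open import Defs
open import Algebra.Bundles using (CommutativeRing)
import Algebra.Properties.Semiring.Sum as Sum
open import Data.Bool.Base using (if_then_else_)
open import Data.Fin.Base using (Fin; zero; suc; _↑ˡ_; _↑ʳ_; combine)
open import Data.Fin.Properties using (remQuot-combine; suc-injective)
open import Data.Integer.Base as ℤ using ()
import Data.Integer.Properties as ℤ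
open import Data.List.Base as List using (List; []; _∷_; _++_; length; filter; cartesianProduct)
open import Data.Nat.Base as ℕ using (ℕ; zero; suc; NonZero; _⊔_; _^_)
import Data.Nat.Properties as ℕ
open import Data.Product.Base using (_×_; _,_; proj₁; ∃-syntax)
open import Data.Product.Properties using (≡-dec)
open import Data.Rational.Base as ℚ using (ℚ; 0ℚ; 1ℚ; ½; _/_; _-_; -_; _≤_; ∣_∣; Positive)
import Data.Rational.Properties as ℚ
open import Data.Rational.Solver using (module +-*-Solver)
open import Data.Rational.Unnormalised.Base as ℚᵘ using (mkℚᵘ; *≡*)
import Data.Rational.Unnormalised.Properties as ℚᵘ
open import Data.Sum.Base using (inj₁; inj₂)
import Data.Vec.Functional as Vector
open import Function.Base using (_∘_; id)
open import Function.Bundles using (_↔_; Inverse; mk↔ₛ′)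
open import Function.Construct.Composition using (_↔-∘_)
open import Function.Construct.Symmetry using (↔-sym)
open import Relation.Binary.PropositionalEquality
open import Relation.Nullary using (Dec; does; yes; no; ¬_)
open import Relation.Nullary.Decidable.Core using (from-yes)
open import Relation.Nullary.Negation using (contradiction)

open +-*-Solver using (solve; _:+_; _:*_; _:-_; :-_; _:=_; con)
open RationalOrder
open Bisection
open Bounds
open FinSet using (Carrier; size; enum; elements)

-- Rational sums and averages over finite sets.

module Expectation where

  open import Data.Rational.Base using (_+_; _*_)
  open Sum (CommutativeRing.semiring ℚ.+-*-commutativeRing)

  toℚ-+ : ∀ m n → toℚ (m ℕ.+ n) ≡ toℚ m + toℚ n
  toℚ-+ zero    n = sym (ℚ.+-identityˡ (toℚ n))
  toℚ-+ (suc m) n = trans (cong (1ℚ +_) (toℚ-+ m n)) (sym (ℚ.+-assoc 1ℚ (toℚ m) (toℚ n)))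

  toℚ-* : ∀ m n → toℚ (m ℕ.* n) ≡ toℚ m * toℚ n
  toℚ-* zero    n = sym (ℚ.*-zeroˡ (toℚ n))
  toℚ-* (suc m) n = begin
    toℚ (n ℕ.+ m ℕ.* n)      ≡⟨ toℚ-+ n (m ℕ.* n) ⟩
    toℚ n + toℚ (m ℕ.* n)    ≡⟨ cong (toℚ n +_) (toℚ-* m n) ⟩
    toℚ n + toℚ m * toℚ n    ≡⟨ solve 2 (λ m n → n :+ m :* n := (con 1ℚ :+ m) :* n) refl (toℚ m) (toℚ n) ⟩
    (1ℚ + toℚ m) * toℚ n     ∎
    where open ≡-Reasoning

  1≤toℚ : ∀ n .{{_ : NonZero n}} → 1ℚ ≤ toℚ n
  1≤toℚ (suc n) = ℚ.+-monoʳ-≤ 1ℚ (0≤toℚ n)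

  abstract
    -- Abstract, so that later proofs use reciprocals only through the lemmas of this block and
    -- never unfold the normalization of fractions.
    recip : ∀ n .{{_ : NonZero n}} → ℚ
    recip n = ℤ.+ 1 / n

    /≡*recip : ∀ m n .{{_ : NonZero n}} → ℤ.+ m / n ≡ recip n * toℚ m
    /≡*recip m (suc n) = trans (ℚ.toℚᵘ-injective (begin
      ℚ.toℚᵘ (ℤ.+ m / suc n)                              ≈⟨ ℚ.toℚᵘ-fromℚᵘ (mkℚᵘ (ℤ.+ m) n) ⟩
      mkℚᵘ (ℤ.+ m) n                                        ≈⟨ *≡* (cong₂ ℤ._*_ (sym (ℤ.*-identityˡ (ℤ.+ m))) (cong ℤ.+_ (ℕ.*-identityʳ (suc n)))) ⟩
      mkℚᵘ (ℤ.+ 1) n ℚᵘ.* mkℚᵘ (ℤ.+ m) 0                      ≈⟨ ℚᵘ.*-cong (ℚ.toℚᵘ-fromℚᵘ (mkℚᵘ (ℤ.+ 1) n)) (ℚ.toℚᵘ-fromℚᵘ (mkℚᵘ (ℤ.+ m) 0)) ⟨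
      ℚ.toℚᵘ (ℤ.+ 1 / suc n) ℚᵘ.* ℚ.toℚᵘ (ℤ.+ m / 1)        ≈⟨ ℚ.toℚᵘ-homo-* (ℤ.+ 1 / suc n) (ℤ.+ m / 1) ⟨
      ℚ.toℚᵘ ((ℤ.+ 1 / suc n) * (ℤ.+ m / 1))                ∎))
      (cong ((ℤ.+ 1 / suc n) *_) (sym (toℚ≡/1 m)))
      where open ℚᵘ.≃-Reasoning

    recip-inverse : ∀ n .{{_ : NonZero n}} → recip n * toℚ n ≡ 1ℚ
    recip-inverse (suc n) = trans (sym (/≡*recip (suc n) (suc n))) (ℚ.toℚᵘ-injective
      (ℚᵘ.≃-trans (ℚ.toℚᵘ-fromℚᵘ (mkℚᵘ (ℤ.+ suc n) n))
                  (*≡* (ℤ.*-comm (ℤ.+ suc n) (ℤ.+ 1)))))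

    0≤recip : ∀ n .{{_ : NonZero n}} → 0ℚ ≤ recip n
    0≤recip n = ℚ.nonNegative⁻¹ _ {{ℚ.normalize-nonNeg 1 n}}

  -- Uniqueness of inverses: both sides are inverse to `toℚ m * toℚ n`, and the proof inserts the
  -- two products equal to 1.
  recip-* : ∀ m n .{{_ : NonZero m}} .{{_ : NonZero n}} →
            recip (m ℕ.* n) {{ℕ.m*n≢0 m n}} ≡ recip m * recip n
  recip-* m n = begin
    r                                         ≡⟨ ℚ.*-identityʳ r ⟨
    r * (1ℚ * 1ℚ)                             ≡⟨ cong₂ (λ p q → r * (p * q)) (recip-inverse m) (recip-inverse n) ⟨
    r * ((recip m * toℚ m) * (recip n * toℚ n))
      ≡⟨ solve 5 (λ r a b c d → r :* ((a :* b) :* (c :* d)) := (r :* (b :* d)) :* (a :* c)) refl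
           r (recip m) (toℚ m) (recip n) (toℚ n) ⟩
    (r * (toℚ m * toℚ n)) * (recip m * recip n)
      ≡⟨ cong (λ p → (r * p) * (recip m * recip n)) (toℚ-* m n) ⟨
    (r * toℚ (m ℕ.* n)) * (recip m * recip n) ≡⟨ cong (_* (recip m * recip n)) (recip-inverse (m ℕ.* n) {{ℕ.m*n≢0 m n}}) ⟩
    1ℚ * (recip m * recip n)                  ≡⟨ ℚ.*-identityˡ _ ⟩
    recip m * recip n                         ∎
    where
    open ≡-Reasoning
    r : ℚ
    r = recip (m ℕ.* n) {{ℕ.m*n≢0 m n}}

  -- Sums over `Fin n`.

  sum-mono : ∀ {n} {f g : Fin n → ℚ} → (∀ i → f i ≤ g i) → sum f ≤ sum g
  sum-mono {zero}  h = ℚ.≤-refl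
  sum-mono {suc n} h = ℚ.+-mono-≤ (h zero) (sum-mono (h ∘ suc))

  sum-const : ∀ n c → sum {n} (λ _ → c) ≡ toℚ n * c
  sum-const zero    c = sym (ℚ.*-zeroˡ c)
  sum-const (suc n) c = trans (cong (c +_) (sum-const n c))
    (solve 2 (λ c t → c :+ t :* c := (con 1ℚ :+ t) :* c) refl c (toℚ n))

  sum-↑ : ∀ m {n} (f : Fin (m ℕ.+ n) → ℚ) → sum f ≡ sum (λ i → f (i ↑ˡ n)) + sum (λ j → f (m ↑ʳ j))
  sum-↑ zero        f = sym (ℚ.+-identityˡ _)
  sum-↑ (suc m) {n} f = trans (cong (f zero +_) (sum-↑ m (f ∘ suc)))
    (sym (ℚ.+-assoc (f zero) (sum (λ i → f (suc i ↑ˡ n))) (sum (λ j → f (suc m ↑ʳ j)))))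

  sum-combine : ∀ m {n} (f : Fin (m ℕ.* n) → ℚ) → sum f ≡ sum (λ i → sum (λ j → f (combine {m} {n} i j)))
  sum-combine zero        f = refl
  sum-combine (suc m) {n} f = trans (sum-↑ n f)
    (cong (sum (λ j → f (j ↑ˡ m ℕ.* n)) +_) (sum-combine m (λ k → f (n ↑ʳ k))))

  sum-single : ∀ {n} (f : Fin n → ℚ) k → (∀ i → i ≢ k → f i ≡ 0ℚ) → sum f ≡ f k
  sum-single {suc n} f zero h = trans
    (cong (f zero +_) (trans (sum-cong-≗ (λ i → h (suc i) λ ())) (sum-replicate-zero n)))
    (ℚ.+-identityʳ (f zero))
  sum-single {suc n} f (suc k) h = trans
    (cong₂ _+_ (h zero λ ()) (sum-single (f ∘ suc) k (λ i i≢k → h (suc i) (i≢k ∘ suc-injective))))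
    (ℚ.+-identityˡ (f (suc k)))

  -- Sums over lists and counting.

  sumList : ∀ {A : Set} → (A → ℚ) → List A → ℚ
  sumList f = List.foldr (λ x s → f x + s) 0ℚ

  sumList-++ : ∀ {A : Set} (f : A → ℚ) xs ys → sumList f (xs ++ ys) ≡ sumList f xs + sumList f ys
  sumList-++ f []       ys = sym (ℚ.+-identityˡ _)
  sumList-++ f (x ∷ xs) ys = trans (cong (f x +_) (sumList-++ f xs ys)) (sym (ℚ.+-assoc (f x) _ _))

  sumList-map : ∀ {A B : Set} (f : B → ℚ) (g : A → B) xs → sumList f (List.map g xs) ≡ sumList (f ∘ g) xs
  sumList-map f g []       = refl
  sumList-map f g (x ∷ xs) = cong (f (g x) +_) (sumList-map f g xs)

  sumList-cartesianProduct : ∀ {A B : Set} (f : A × B → ℚ) xs ys →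
    sumList f (cartesianProduct xs ys) ≡ sumList (λ x → sumList (λ y → f (x , y)) ys) xs
  sumList-cartesianProduct f []       ys = refl
  sumList-cartesianProduct f (x ∷ xs) ys = trans (sumList-++ f (List.map (x ,_) ys) _)
    (cong₂ _+_ (sumList-map f (x ,_) ys) (sumList-cartesianProduct f xs ys))

  sumList-tabulate : ∀ {n} {A : Set} (f : A → ℚ) (g : Fin n → A) →
                     sumList f (List.tabulate g) ≡ sum (f ∘ g)
  sumList-tabulate {zero}  f g = refl
  sumList-tabulate {suc n} f g = cong (f (g zero) +_) (sumList-tabulate f (g ∘ suc))

  indicator : ∀ {P : Set} → Dec P → ℚ
  indicator P? = if does P? then 1ℚ else 0ℚ

  -- Turns the edge count of the adjacency matrix into a sum of indicators, which can be rearranged.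
  toℚ-length-filter : ∀ {A : Set} {P : A → Set} (P? : ∀ x → Dec (P x)) xs →
                      toℚ (length (filter P? xs)) ≡ sumList (indicator ∘ P?) xs
  toℚ-length-filter P? [] = refl
  toℚ-length-filter P? (x ∷ xs) with P? x
  ... | yes _ = cong (1ℚ +_) (toℚ-length-filter P? xs)
  ... | no  _ = trans (toℚ-length-filter P? xs) (sym (ℚ.+-identityˡ _))

  -- Sums indexed by a `FinSet`.

  abstract
    ∑ : (A : FinSet) → (Carrier A → ℚ) → ℚ
    ∑ A f = sum (f ∘ Inverse.from (enum A))

    ∑-cong : ∀ A {f g : Carrier A → ℚ} → (∀ x → f x ≡ g x) → ∑ A f ≡ ∑ A g
    ∑-cong A h = sum-cong-≗ (h ∘ Inverse.from (enum A))

    ∑-mono : ∀ A {f g : Carrier A → ℚ} → (∀ x → f x ≤ g x) → ∑ A f ≤ ∑ A g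
    ∑-mono A h = sum-mono (h ∘ Inverse.from (enum A))

    ∑-const : ∀ A c → ∑ A (λ _ → c) ≡ toℚ (size A) * c
    ∑-const A c = sum-const (size A) c

    ∑-+ : ∀ A (f g : Carrier A → ℚ) → ∑ A (λ x → f x + g x) ≡ ∑ A f + ∑ A g
    ∑-+ A f g = ∑-distrib-+ (f ∘ Inverse.from (enum A)) (g ∘ Inverse.from (enum A))

    ∑-*ˡ : ∀ A c (f : Carrier A → ℚ) → ∑ A (λ x → c * f x) ≡ c * ∑ A f
    ∑-*ˡ A c f = sym (*-distribˡ-sum c (f ∘ Inverse.from (enum A)))

    ∑-swap : ∀ A B (f : Carrier A → Carrier B → ℚ) →
             ∑ A (λ x → ∑ B (f x)) ≡ ∑ B (λ y → ∑ A (λ x → f x y))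
    ∑-swap A B f = ∑-comm (λ i j → f (Inverse.from (enum A) i) (Inverse.from (enum B) j))

    -- The enumeration of `A ⊗ B` decodes an index with `remQuot`, which inverts the `combine` that
    -- `sum-combine` produces.
    ∑-⊗ : ∀ A B (f : Carrier (A ⊗ B) → ℚ) → ∑ (A ⊗ B) f ≡ ∑ A (λ x → ∑ B (λ y → f (x , y)))
    ∑-⊗ A B f = trans (sum-combine (size A) {size B} (f ∘ Inverse.from (enum (A ⊗ B))))
      (sum-cong-≗ λ i → sum-cong-≗ λ j →
        cong (λ (k , l) → f (Inverse.from (enum A) k , Inverse.from (enum B) l)) (remQuot-combine i j))

    -- Conjugating `φ` by the two enumerations gives a bijection from `Fin (size A)` to
    -- `Fin (size B)`, along which the sum is permuted; the sizes need not be known to agree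
    -- beforehand.
    ∑-↔ : ∀ A B (φ : Carrier A ↔ Carrier B) (f : Carrier B → ℚ) → ∑ A (f ∘ Inverse.to φ) ≡ ∑ B f
    ∑-↔ A B φ f = sym (trans
      (sum-permute (f ∘ Inverse.from (enum B)) (enum B ↔-∘ (φ ↔-∘ ↔-sym (enum A))))
      (sum-cong-≗ λ i → cong f (Inverse.strictlyInverseʳ (enum B) (Inverse.to φ (Inverse.from (enum A) i)))))

    ∑-single : ∀ A (f : Carrier A → ℚ) a → (∀ x → x ≢ a → f x ≡ 0ℚ) → ∑ A f ≡ f a
    ∑-single A f a h = trans
      (sum-single (f ∘ Inverse.from (enum A)) (Inverse.to (enum A) a)
        (λ i i≢ → h _ λ eq → i≢ (trans (sym (Inverse.strictlyInverseˡ (enum A) i)) (cong (Inverse.to (enum A)) eq))))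
      (cong f (Inverse.strictlyInverseʳ (enum A) a))

    sumList-elements : ∀ A (f : Carrier A → ℚ) → sumList f (elements A) ≡ ∑ A f
    sumList-elements A f = trans (sumList-map f (Inverse.from (enum A)) (List.allFin (size A)))
      (sumList-tabulate (f ∘ Inverse.from (enum A)) id)

    -- Real addition is termwise, so each term of a real sum is a rational sum. This is what lets
    -- statements about real vectors be checked one index at a time.
    seq-Σᵣ : ∀ A f n → seq (Σᵣ A f) n ≡ ∑ A (λ x → seq (f x) n)
    seq-Σᵣ A f n = go (size A) (f ∘ Inverse.from (enum A))
      where
      go : ∀ k (g : Fin k → ℝ) → seq (Vector.foldr _+ᵣ_ 0ᵣ g) n ≡ sum (λ i → seq (g i) n)
      go zero    g = refl
      go (suc k) g = cong (seq (g zero) n +_) (go k (g ∘ suc))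

    -- Uniform averages.

    𝔼 : (A : FinSet) → (Carrier A → ℚ) → ℚ
    𝔼 A f = recip (size A) * ∑ A f

    size*𝔼 : ∀ A (f : Carrier A → ℚ) → toℚ (size A) * 𝔼 A f ≡ ∑ A f
    size*𝔼 A f = begin
      toℚ (size A) * (recip (size A) * ∑ A f)
        ≡⟨ solve 3 (λ n r s → n :* (r :* s) := (r :* n) :* s) refl (toℚ (size A)) (recip (size A)) (∑ A f) ⟩
      (recip (size A) * toℚ (size A)) * ∑ A f ≡⟨ cong (_* ∑ A f) (recip-inverse (size A)) ⟩
      1ℚ * ∑ A f                              ≡⟨ ℚ.*-identityˡ _ ⟩
      ∑ A f                                   ∎
      where open ≡-Reasoning

    𝔼-def : ∀ A (f : Carrier A → ℚ) → 𝔼 A f ≡ recip (size A) * ∑ A f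
    𝔼-def A f = refl

    𝔼-cong : ∀ A {f g : Carrier A → ℚ} → (∀ x → f x ≡ g x) → 𝔼 A f ≡ 𝔼 A g
    𝔼-cong A h = cong (recip (size A) *_) (∑-cong A h)

    𝔼-mono : ∀ A {f g : Carrier A → ℚ} → (∀ x → f x ≤ g x) → 𝔼 A f ≤ 𝔼 A g
    𝔼-mono A h = ℚ.*-monoˡ-≤-nonNeg (recip (size A)) {{ℚ.nonNegative (0≤recip (size A))}} (∑-mono A h)

    𝔼-const : ∀ A c → 𝔼 A (λ _ → c) ≡ c
    𝔼-const A c = begin
      recip (size A) * ∑ A (λ _ → c)       ≡⟨ cong (recip (size A) *_) (∑-const A c) ⟩
      recip (size A) * (toℚ (size A) * c)  ≡⟨ ℚ.*-assoc (recip (size A)) _ c ⟨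
      (recip (size A) * toℚ (size A)) * c  ≡⟨ cong (_* c) (recip-inverse (size A)) ⟩
      1ℚ * c                               ≡⟨ ℚ.*-identityˡ c ⟩
      c                                    ∎
      where open ≡-Reasoning

    𝔼-+ : ∀ A (f g : Carrier A → ℚ) → 𝔼 A (λ x → f x + g x) ≡ 𝔼 A f + 𝔼 A g
    𝔼-+ A f g = trans (cong (recip (size A) *_) (∑-+ A f g)) (ℚ.*-distribˡ-+ (recip (size A)) _ _)

    𝔼-*ˡ : ∀ A c (f : Carrier A → ℚ) → 𝔼 A (λ x → c * f x) ≡ c * 𝔼 A f
    𝔼-*ˡ A c f = trans (cong (recip (size A) *_) (∑-*ˡ A c f))
      (solve 3 (λ r c s → r :* (c :* s) := c :* (r :* s)) refl (recip (size A)) c (∑ A f))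

    𝔼-⊗ : ∀ A B (f : Carrier (A ⊗ B) → ℚ) → 𝔼 (A ⊗ B) f ≡ 𝔼 A (λ x → 𝔼 B (λ y → f (x , y)))
    𝔼-⊗ A B f = begin
      recip (size A ℕ.* size B) {{FinSet.nonEmpty (A ⊗ B)}} * ∑ (A ⊗ B) f
        ≡⟨ cong₂ _*_ (recip-* (size A) (size B)) (∑-⊗ A B f) ⟩
      (recip (size A) * recip (size B)) * ∑ A (λ x → ∑ B (λ y → f (x , y)))
        ≡⟨ ℚ.*-assoc (recip (size A)) _ _ ⟩
      recip (size A) * (recip (size B) * ∑ A (λ x → ∑ B (λ y → f (x , y))))
        ≡⟨ cong (recip (size A) *_) (∑-*ˡ A (recip (size B)) (λ x → ∑ B (λ y → f (x , y)))) ⟨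
      recip (size A) * ∑ A (λ x → recip (size B) * ∑ B (λ y → f (x , y))) ∎
      where open ≡-Reasoning

    𝔼-↔ : ∀ A B (φ : Carrier A ↔ Carrier B) (f : Carrier B → ℚ) → 𝔼 A (f ∘ Inverse.to φ) ≡ 𝔼 B f
    𝔼-↔ A B φ f = begin
      𝔼 A g                                     ≡⟨ ℚ.*-identityˡ _ ⟨
      1ℚ * 𝔼 A g                                ≡⟨ cong (_* 𝔼 A g) (recip-inverse (size B)) ⟨
      (recip (size B) * toℚ (size B)) * 𝔼 A g   ≡⟨ cong (λ p → (recip (size B) * p) * 𝔼 A g) sizes ⟨
      (recip (size B) * toℚ (size A)) * 𝔼 A g   ≡⟨ ℚ.*-assoc (recip (size B)) _ _ ⟩
      recip (size B) * (toℚ (size A) * 𝔼 A g)   ≡⟨ cong (recip (size B) *_) (trans (size*𝔼 A g) (∑-↔ A B φ f)) ⟩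
      recip (size B) * ∑ B f                    ∎
      where
      open ≡-Reasoning
      g : Carrier A → ℚ
      g = f ∘ Inverse.to φ
      -- The cardinalities agree because summing the constant 1 commutes with the bijection.
      sizes : toℚ (size A) ≡ toℚ (size B)
      sizes = begin
        toℚ (size A)       ≡⟨ ℚ.*-identityʳ _ ⟨
        toℚ (size A) * 1ℚ  ≡⟨ ∑-const A 1ℚ ⟨
        ∑ A (λ _ → 1ℚ)     ≡⟨ ∑-↔ A B φ (λ _ → 1ℚ) ⟩
        ∑ B (λ _ → 1ℚ)     ≡⟨ ∑-const B 1ℚ ⟩
        toℚ (size B) * 1ℚ  ≡⟨ ℚ.*-identityʳ _ ⟩
        toℚ (size B)       ∎

open Expectation

-- Inner products and quadratic forms on rational functions.

module Spectrum where

  open import Data.Rational.Base using (_+_; _*_)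

  ∣p∣≤q : ∀ {p q} → p ≤ q → - p ≤ q → ∣ p ∣ ≤ q
  ∣p∣≤q {p} {q} p≤q -p≤q with ℚ.∣p∣≡p∨∣p∣≡-p p
  ... | inj₁ eq = subst (_≤ q) (sym eq) p≤q
  ... | inj₂ eq = subst (_≤ q) (sym eq) -p≤q

  -p≤∣p∣ : ∀ p → - p ≤ ∣ p ∣
  -p≤∣p∣ p = subst (- p ≤_) (ℚ.∣-p∣≡∣p∣ p) (p≤∣p∣ (- p))

  0≤p² : ∀ p → 0ℚ ≤ p * p
  0≤p² p with ℚ.≤-total 0ℚ p
  ... | inj₁ 0≤p = 0≤p*q 0≤p 0≤p
  ... | inj₂ p≤0 = subst (0ℚ ≤_) (solve 1 (λ p → (:- p) :* (:- p) := p :* p) refl p) (0≤p*q 0≤-p 0≤-p)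
    where
    0≤-p : 0ℚ ≤ - p
    0≤-p = ≤-arith p≤0 (solve 1 (λ p → (:- p) :- con 0ℚ := con 0ℚ :- p) refl p)

  𝔼-linear : ∀ A c d (f g : Carrier A → ℚ) →
             𝔼 A (λ x → c * f x + d * g x) ≡ c * 𝔼 A f + d * 𝔼 A g
  𝔼-linear A c d f g = trans (𝔼-+ A (λ x → c * f x) (λ x → d * g x)) (cong₂ _+_ (𝔼-*ˡ A c f) (𝔼-*ˡ A d g))

  0≤𝔼 : ∀ A {f : Carrier A → ℚ} → (∀ x → 0ℚ ≤ f x) → 0ℚ ≤ 𝔼 A f
  0≤𝔼 A {f} h = subst (_≤ 𝔼 A f) (𝔼-const A 0ℚ) (𝔼-mono A h)

  inner : (A : FinSet) (f g : Carrier A → ℚ) → ℚ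
  inner A f g = 𝔼 A (λ x → f x * g x)

  inner-cong : ∀ A {f f′ g g′ : Carrier A → ℚ} → (∀ x → f x ≡ f′ x) → (∀ x → g x ≡ g′ x) →
               inner A f g ≡ inner A f′ g′
  inner-cong A h k = 𝔼-cong A (λ x → cong₂ _*_ (h x) (k x))

  inner-comm : ∀ A (f g : Carrier A → ℚ) → inner A f g ≡ inner A g f
  inner-comm A f g = 𝔼-cong A (λ x → ℚ.*-comm (f x) (g x))

  inner-linearˡ : ∀ A c d (f g h : Carrier A → ℚ) →
                  inner A (λ x → c * f x + d * g x) h ≡ c * inner A f h + d * inner A g h
  inner-linearˡ A c d f g h = trans
    (𝔼-cong A (λ x → solve 5 (λ c d f g h → (c :* f :+ d :* g) :* h := c :* (f :* h) :+ d :* (g :* h))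
                       refl c d (f x) (g x) (h x)))
    (𝔼-linear A c d (λ x → f x * h x) (λ x → g x * h x))

  inner-linearʳ : ∀ A c d (h f g : Carrier A → ℚ) →
                  inner A h (λ x → c * f x + d * g x) ≡ c * inner A h f + d * inner A h g
  inner-linearʳ A c d h f g = begin
    inner A h (λ x → c * f x + d * g x)    ≡⟨ inner-comm A h (λ x → c * f x + d * g x) ⟩
    inner A (λ x → c * f x + d * g x) h    ≡⟨ inner-linearˡ A c d f g h ⟩
    c * inner A f h + d * inner A g h      ≡⟨ cong₂ (λ p q → c * p + d * q) (inner-comm A f h) (inner-comm A g h) ⟩
    c * inner A h f + d * inner A h g      ∎
    where open ≡-Reasoning

  inner-+ : ∀ A (f g h k : Carrier A → ℚ) →
            inner A (λ x → f x + g x) (λ x → h x + k x) ≡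
            inner A f h + inner A f k + inner A g h + inner A g k
  inner-+ A f g h k = begin
    inner A (λ x → f x + g x) (λ x → h x + k x)
      ≡⟨ 𝔼-cong A (λ x → solve 4 (λ f g h k → (f :+ g) :* (h :+ k) := f :* h :+ f :* k :+ g :* h :+ g :* k)
                           refl (f x) (g x) (h x) (k x)) ⟩
    𝔼 A (λ x → f x * h x + f x * k x + g x * h x + g x * k x)
      ≡⟨ 𝔼-+ A (λ x → f x * h x + f x * k x + g x * h x) (λ x → g x * k x) ⟩
    𝔼 A (λ x → f x * h x + f x * k x + g x * h x) + inner A g k
      ≡⟨ cong (_+ inner A g k) (𝔼-+ A (λ x → f x * h x + f x * k x) (λ x → g x * h x)) ⟩
    𝔼 A (λ x → f x * h x + f x * k x) + inner A g h + inner A g k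
      ≡⟨ cong (λ p → p + inner A g h + inner A g k) (𝔼-+ A (λ x → f x * h x) (λ x → f x * k x)) ⟩
    inner A f h + inner A f k + inner A g h + inner A g k ∎
    where open ≡-Reasoning

  0≤inner : ∀ A (f : Carrier A → ℚ) → 0ℚ ≤ inner A f f
  0≤inner A f = 0≤𝔼 A (λ x → 0≤p² (f x))

  -- Expands `‖ t f ± g ‖² ≥ 0`. It takes the place of the Cauchy-Schwarz inequality, so that no
  -- square roots enter; the weight `t` is chosen at each use.
  am-gm : ∀ A t (f g : Carrier A → ℚ) → 0ℚ ≤ t →
          (t + t) * ∣ inner A f g ∣ ≤ (t * t) * inner A f f + inner A g g
  am-gm A t f g 0≤t = begin
    (t + t) * ∣ inner A f g ∣      ≡⟨ cong (_* ∣ inner A f g ∣) (ℚ.0≤p⇒∣p∣≡p (0≤p+q 0≤t 0≤t)) ⟨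
    ∣ t + t ∣ * ∣ inner A f g ∣    ≡⟨ ℚ.∣p*q∣≡∣p∣*∣q∣ (t + t) (inner A f g) ⟨
    ∣ (t + t) * inner A f g ∣      ≤⟨ ∣p∣≤q
      (≤-arith (0≤square (- 1ℚ)) (solve 4 (λ t f p g →
        (t :* t :* f :+ g) :- (t :+ t) :* p :=
        (t :* (t :* f :+ :- con 1ℚ :* p) :+ :- con 1ℚ :* (t :* p :+ :- con 1ℚ :* g)) :- con 0ℚ)
        refl t F P G))
      (≤-arith (0≤square 1ℚ) (solve 4 (λ t f p g →
        (t :* t :* f :+ g) :- (:- ((t :+ t) :* p)) :=
        (t :* (t :* f :+ con 1ℚ :* p) :+ con 1ℚ :* (t :* p :+ con 1ℚ :* g)) :- con 0ℚ)
        refl t F P G)) ⟩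
    (t * t) * F + G ∎
    where
    open ℚ.≤-Reasoning
    F P G : ℚ
    F = inner A f f
    P = inner A f g
    G = inner A g g
    0≤square : ∀ d → 0ℚ ≤ t * (t * F + d * P) + d * (t * P + d * G)
    0≤square d = subst (0ℚ ≤_)
      (trans (inner-linearˡ A t d f g (λ x → t * f x + d * g x)) (cong₂ (λ p q → t * p + d * q)
        (inner-linearʳ A t d f f g)
        (trans (inner-linearʳ A t d g f g) (cong (λ p → t * p + d * G) (inner-comm A g f)))))
      (0≤inner A (λ x → t * f x + d * g x))

  -- The walk operator of a graph.

  module _ {V L : FinSet} (G : Graph V L) where

    rotation : Carrier (V ⊗ L) ↔ Carrier (V ⊗ L)
    rotation = mk↔ₛ′ (Rot G) (Rot G) (involutive G) (involutive G)

    neighbour : Carrier V × Carrier L → Carrier V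
    neighbour x = proj₁ (Rot G x)

    walk : (Carrier V → ℚ) → Carrier V → ℚ
    walk a v = 𝔼 L (λ i → a (neighbour (v , i)))

    walk-cong : ∀ {a b} → (∀ v → a v ≡ b v) → ∀ v → walk a v ≡ walk b v
    walk-cong h v = 𝔼-cong L (λ i → h (neighbour (v , i)))

    walk-linear : ∀ c d a b v → walk (λ w → c * a w + d * b w) v ≡ c * walk a v + d * walk b v
    walk-linear c d a b v = 𝔼-linear L c d (λ i → a (neighbour (v , i))) (λ i → b (neighbour (v , i)))

    walk-const : ∀ c v → walk (λ _ → c) v ≡ c
    walk-const c v = 𝔼-const L c

    -- Rewrites the form as an average over all pairs of a vertex and a label, the set that `Rot G`
    -- permutes.
    inner-walk : ∀ a b → inner V (walk a) b ≡ 𝔼 (V ⊗ L) (λ x → a (neighbour x) * b (proj₁ x))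
    inner-walk a b = sym (trans (𝔼-⊗ V L (λ x → a (neighbour x) * b (proj₁ x))) (𝔼-cong V (λ v → begin
      𝔼 L (λ i → a (neighbour (v , i)) * b v)  ≡⟨ 𝔼-cong L (λ i → ℚ.*-comm (a (neighbour (v , i))) (b v)) ⟩
      𝔼 L (λ i → b v * a (neighbour (v , i)))  ≡⟨ 𝔼-*ˡ L (b v) (λ i → a (neighbour (v , i))) ⟩
      b v * walk a v                           ≡⟨ ℚ.*-comm (b v) (walk a v) ⟩
      walk a v * b v                           ∎)))
      where open ≡-Reasoning

    -- Reindexing by `Rot G` exchanges the two ends of every edge, since `Rot G` is an involution.
    walk-symmetric : ∀ a b → inner V (walk a) b ≡ inner V a (walk b)
    walk-symmetric a b = begin
      inner V (walk a) b                                      ≡⟨ inner-walk a b ⟩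
      𝔼 (V ⊗ L) (λ x → a (neighbour x) * b (proj₁ x))
        ≡⟨ 𝔼-cong (V ⊗ L) (λ x → trans (cong (λ y → a (neighbour x) * b (proj₁ y)) (sym (involutive G x)))
                                       (ℚ.*-comm (a (neighbour x)) (b (neighbour (Rot G x))))) ⟩
      𝔼 (V ⊗ L) (λ x → b (neighbour (Rot G x)) * a (neighbour x))
        ≡⟨ 𝔼-↔ (V ⊗ L) (V ⊗ L) rotation (λ x → b (neighbour x) * a (proj₁ x)) ⟩
      𝔼 (V ⊗ L) (λ x → b (neighbour x) * a (proj₁ x))         ≡⟨ inner-walk b a ⟨
      inner V (walk b) a                                      ≡⟨ inner-comm V (walk b) a ⟩
      inner V a (walk b)                                      ∎
      where open ≡-Reasoning

    -- Self-adjointness against the constant 1, which the walk fixes. Hence the mean-zero functions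
    -- are an invariant subspace.
    𝔼-walk : ∀ a → 𝔼 V (walk a) ≡ 𝔼 V a
    𝔼-walk a = begin
      𝔼 V (walk a)                  ≡⟨ 𝔼-cong V (λ v → ℚ.*-identityʳ (walk a v)) ⟨
      inner V (walk a) (λ _ → 1ℚ)   ≡⟨ walk-symmetric a (λ _ → 1ℚ) ⟩
      inner V a (walk (λ _ → 1ℚ))   ≡⟨ 𝔼-cong V (λ v → trans (cong (a v *_) (walk-const 1ℚ v)) (ℚ.*-identityʳ (a v))) ⟩
      𝔼 V a                         ∎
      where open ≡-Reasoning

    FormBound : ℚ → Set
    FormBound c = ∀ a → 𝔼 V a ≡ 0ℚ → ∣ inner V (walk a) a ∣ ≤ c * inner V a a

    -- The inequality `‖ walk a ‖ ≤ c ‖ a ‖` with both sides squared, so that it stays within the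
    -- rationals.
    NormBound : ℚ → Set
    NormBound c = ∀ a → 𝔼 V a ≡ 0ℚ → inner V (walk a) (walk a) ≤ (c * c) * inner V a a

    FormBound-mono : ∀ {c d} → c ≤ d → FormBound c → FormBound d
    FormBound-mono c≤d h a a⊥1 = ℚ.≤-trans (h a a⊥1)
      (ℚ.*-monoʳ-≤-nonNeg (inner V a a) {{ℚ.nonNegative (0≤inner V a)}} c≤d)

    -- Polarization: the form at c·a + walk a and at c·a - walk a.
    form⇒norm : ∀ c .{{_ : Positive c}} → FormBound c → NormBound c
    form⇒norm c h a a⊥1 = ℚ.*-cancelˡ-≤-pos (c + c) {{ℚ.pos+pos⇒pos c c}} (≤-arith
      (ℚ.+-mono-≤
        (ℚ.≤-trans (p≤∣p∣ (inner V (walk (x 1ℚ)) (x 1ℚ))) (h (x 1ℚ) (x⊥1 1ℚ)))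
        (ℚ.≤-trans (-p≤∣p∣ (inner V (walk (x (- 1ℚ))) (x (- 1ℚ)))) (h (x (- 1ℚ)) (x⊥1 (- 1ℚ)))))
      (trans
        (solve 5 (λ c A S P T → let e = :- con 1ℚ in
          (c :+ c) :* (c :* c :* A) :- (c :+ c) :* P :=
          (c :* (c :* (c :* A :+ con 1ℚ :* S) :+ con 1ℚ :* (c :* S :+ con 1ℚ :* P)) :+
           c :* (c :* (c :* A :+ e :* S) :+ e :* (c :* S :+ e :* P))) :-
          ((c :* (c :* S :+ con 1ℚ :* P) :+ con 1ℚ :* (c :* P :+ con 1ℚ :* T)) :+
           :- (c :* (c :* S :+ e :* P) :+ e :* (c :* P :+ e :* T))))
          refl c (inner V a a) (inner V p a) (inner V p p) (inner V (walk p) p))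
        (cong₂ _-_
          (cong₂ (λ u v → c * u + c * v) (sym (norm 1ℚ)) (sym (norm (- 1ℚ))))
          (cong₂ (λ u v → u + - v) (sym (form 1ℚ)) (sym (form (- 1ℚ)))))))
      where
      p : Carrier V → ℚ
      p = walk a
      x : ℚ → Carrier V → ℚ
      x d v = c * a v + d * p v
      x⊥1 : ∀ d → 𝔼 V (x d) ≡ 0ℚ
      x⊥1 d = trans (𝔼-linear V c d a p) (trans
        (cong₂ (λ u v → c * u + d * v) a⊥1 (trans (𝔼-walk a) a⊥1))
        (solve 2 (λ c d → c :* con 0ℚ :+ d :* con 0ℚ := con 0ℚ) refl c d))
      expand : ∀ d f g → inner V (λ v → c * f v + d * g v) (x d) ≡
               c * (c * inner V f a + d * inner V f p) + d * (c * inner V g a + d * inner V g p)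
      expand d f g = trans (inner-linearˡ V c d f g (x d))
        (cong₂ (λ u v → c * u + d * v) (inner-linearʳ V c d f a p) (inner-linearʳ V c d g a p))
      norm : ∀ d → inner V (x d) (x d) ≡
             c * (c * inner V a a + d * inner V p a) + d * (c * inner V p a + d * inner V p p)
      norm d = trans (expand d a p)
        (cong (λ u → c * (c * inner V a a + d * u) + d * (c * inner V p a + d * inner V p p)) (inner-comm V a p))
      form : ∀ d → inner V (walk (x d)) (x d) ≡
             c * (c * inner V p a + d * inner V p p) + d * (c * inner V p p + d * inner V (walk p) p)
      form d = trans (inner-cong V {g = x d} (walk-linear c d a p) (λ _ → refl)) (trans (expand d p (walk p))
        (cong (λ u → c * (c * inner V p a + d * inner V p p) + d * (c * u + d * inner V (walk p) p))
          (walk-symmetric p a)))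

  walk-square : ∀ {V L} (G : Graph V L) a v → walk (square G) a v ≡ walk G (walk G a) v
  walk-square {V} {L} G a v = 𝔼-⊗ L L (λ i → a (neighbour (square G) (v , i)))

  walk-relabel : ∀ {V L L′} (φ : Carrier L ↔ Carrier L′) (G : Graph V L) a v →
                 walk (relabel {V} {L} {L′} φ G) a v ≡ walk G a v
  walk-relabel {V} {L} {L′} φ G a v = 𝔼-↔ L′ L (↔-sym φ) (λ i → a (neighbour G (v , i)))

  FormBound-relabel : ∀ {V L L′} (φ : Carrier L ↔ Carrier L′) (G : Graph V L) {c} →
                      FormBound G c → FormBound (relabel {V} {L} {L′} φ G) c
  FormBound-relabel {V} {L} {L′} φ G {c} h a a⊥1 = subst (λ p → ∣ p ∣ ≤ c * inner V a a)
    (inner-cong V {g = a} (λ v → sym (walk-relabel {V} {L} {L′} φ G a v)) (λ _ → refl)) (h a a⊥1)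

  -- By self-adjointness the form of the two-step walk is `‖ walk a ‖²`, which is nonnegative and is
  -- what `NormBound` controls.
  FormBound-square : ∀ {V L} (G : Graph V L) {c} → NormBound G c → FormBound (square G) (c * c)
  FormBound-square {V} {L} G {c} h a a⊥1 = begin
    ∣ inner V (walk (square G) a) a ∣    ≡⟨ cong ∣_∣ (trans (inner-cong V {g = a} (walk-square G a) (λ _ → refl))
                                                           (walk-symmetric G (walk G a) a)) ⟩
    ∣ inner V (walk G a) (walk G a) ∣    ≡⟨ ℚ.0≤p⇒∣p∣≡p (0≤inner V (walk G a)) ⟩
    inner V (walk G a) (walk G a)        ≤⟨ h a a⊥1 ⟩
    (c * c) * inner V a a                ∎
    where open ℚ.≤-Reasoning

  -- The zig-zag product.

  module ZigZag {V L K : FinSet} (G : Graph V L) (H : Graph L K) where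

    -- The tensor product of the identity on `V` with the walk operator of `H`.
    fibreWalk : (Carrier (V ⊗ L) → ℚ) → Carrier (V ⊗ L) → ℚ
    fibreWalk a (v , l) = walk H (λ k → a (v , k)) l

    -- The two halves of the edge label are independent: averaging over the second gives the inner
    -- `fibreWalk`, evaluated after the step of `Rot G`, and averaging over the first gives the
    -- outer one.
    walk-zigzag : ∀ a x → walk (zigzag G H) a x ≡ fibreWalk (fibreWalk a ∘ Rot G) x
    walk-zigzag a x = 𝔼-⊗ K K (λ i → a (neighbour (zigzag G H) (x , i)))

    fibreWalk-symmetric : ∀ a b → inner (V ⊗ L) (fibreWalk a) b ≡ inner (V ⊗ L) a (fibreWalk b)
    fibreWalk-symmetric a b = begin
      inner (V ⊗ L) (fibreWalk a) b
        ≡⟨ 𝔼-⊗ V L (λ x → fibreWalk a x * b x) ⟩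
      𝔼 V (λ v → inner L (walk H (λ k → a (v , k))) (λ k → b (v , k)))
        ≡⟨ 𝔼-cong V (λ v → walk-symmetric H (λ k → a (v , k)) (λ k → b (v , k))) ⟩
      𝔼 V (λ v → inner L (λ k → a (v , k)) (walk H (λ k → b (v , k))))
        ≡⟨ 𝔼-⊗ V L (λ x → a x * fibreWalk b x) ⟨
      inner (V ⊗ L) a (fibreWalk b) ∎
      where open ≡-Reasoning

    form-zigzag : ∀ a → inner (V ⊗ L) (walk (zigzag G H) a) a ≡
                        inner (V ⊗ L) (fibreWalk a ∘ Rot G) (fibreWalk a)
    form-zigzag a = trans (inner-cong (V ⊗ L) {g = a} (walk-zigzag a) (λ _ → refl))
                          (fibreWalk-symmetric (fibreWalk a ∘ Rot G) a)

    module Decomposition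
      (c μ : ℚ) (0≤c : 0ℚ ≤ c) .{{_ : Positive μ}} (G-bound : FormBound G c) (H-bound : NormBound H μ)
      (a : Carrier (V ⊗ L) → ℚ) (a⊥1 : 𝔼 (V ⊗ L) a ≡ 0ℚ) where

      -- a = x + y with x constant on the fibres and y of mean zero on each fibre.
      s : Carrier V → ℚ
      s v = 𝔼 L (λ k → a (v , k))

      x y e : Carrier (V ⊗ L) → ℚ
      x (v , _) = s v
      y z       = a z - x z
      e         = fibreWalk y

      private
        0≤μ : 0ℚ ≤ μ
        0≤μ = ℚ.<⇒≤ (ℚ.positive⁻¹ μ)

      a≡x+y : ∀ z → a z ≡ x z + y z
      a≡x+y z = solve 2 (λ a x → a := x :+ (a :- x)) refl (a z) (x z)

      y⊥1 : ∀ v → 𝔼 L (λ k → y (v , k)) ≡ 0ℚ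
      y⊥1 v = begin
        𝔼 L (λ k → a (v , k) - s v)
          ≡⟨ 𝔼-+ L (λ k → a (v , k)) (λ _ → - s v) ⟩
        s v + 𝔼 L (λ _ → - s v)      ≡⟨ cong (s v +_) (𝔼-const L (- s v)) ⟩
        s v - s v                    ≡⟨ ℚ.+-inverseʳ (s v) ⟩
        0ℚ                           ∎
        where open ≡-Reasoning

      fibreWalk≡x+e : ∀ z → fibreWalk a z ≡ x z + e z
      fibreWalk≡x+e (v , l) = begin
        walk H (λ k → a (v , k)) l            ≡⟨ walk-cong H (λ k → a≡x+y (v , k)) l ⟩
        walk H (λ k → s v + y (v , k)) l      ≡⟨ 𝔼-+ K (λ _ → s v) (λ i → y (v , neighbour H (l , i))) ⟩
        walk H (λ _ → s v) l + e (v , l)      ≡⟨ cong (_+ e (v , l)) (walk-const H (s v) l) ⟩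
        s v + e (v , l)                       ∎
        where open ≡-Reasoning

      s⊥1 : 𝔼 V s ≡ 0ℚ
      s⊥1 = trans (sym (𝔼-⊗ V L a)) a⊥1

      X Y E : ℚ
      X = inner (V ⊗ L) x x
      Y = inner (V ⊗ L) y y
      E = inner (V ⊗ L) e e

      X≡s² : X ≡ inner V s s
      X≡s² = trans (𝔼-⊗ V L (λ z → x z * x z)) (𝔼-cong V (λ v → 𝔼-const L (s v * s v)))

      x⊥y : inner (V ⊗ L) x y ≡ 0ℚ
      x⊥y = begin
        inner (V ⊗ L) x y                            ≡⟨ 𝔼-⊗ V L (λ z → x z * y z) ⟩
        𝔼 V (λ v → 𝔼 L (λ k → s v * y (v , k)))      ≡⟨ 𝔼-cong V (λ v → trans (𝔼-*ˡ L (s v) (λ k → y (v , k)))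
                                                          (trans (cong (s v *_) (y⊥1 v)) (ℚ.*-zeroʳ (s v)))) ⟩
        𝔼 V (λ _ → 0ℚ)                               ≡⟨ 𝔼-const V 0ℚ ⟩
        0ℚ                                           ∎
        where open ≡-Reasoning

      pythagoras : inner (V ⊗ L) a a ≡ X + Y
      pythagoras = begin
        inner (V ⊗ L) a a
          ≡⟨ inner-cong (V ⊗ L) a≡x+y a≡x+y ⟩
        inner (V ⊗ L) (λ z → x z + y z) (λ z → x z + y z)
          ≡⟨ inner-+ (V ⊗ L) x y x y ⟩
        X + inner (V ⊗ L) x y + inner (V ⊗ L) y x + Y
          ≡⟨ cong₂ (λ p q → X + p + q + Y) x⊥y (trans (inner-comm (V ⊗ L) y x) x⊥y) ⟩
        X + 0ℚ + 0ℚ + Y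
          ≡⟨ solve 2 (λ X Y → X :+ con 0ℚ :+ con 0ℚ :+ Y := X :+ Y) refl X Y ⟩
        X + Y ∎
        where open ≡-Reasoning

      -- `y` has mean zero on every fibre, so the bound for `H` applies to each fibre separately and
      -- is then averaged over `V`.
      E≤μ²Y : E ≤ (μ * μ) * Y
      E≤μ²Y = begin
        E
          ≡⟨ 𝔼-⊗ V L (λ z → e z * e z) ⟩
        𝔼 V (λ v → inner L (walk H (λ k → y (v , k))) (walk H (λ k → y (v , k))))
          ≤⟨ 𝔼-mono V (λ v → H-bound (λ k → y (v , k)) (y⊥1 v)) ⟩
        𝔼 V (λ v → (μ * μ) * inner L (λ k → y (v , k)) (λ k → y (v , k)))
          ≡⟨ 𝔼-*ˡ V (μ * μ) (λ v → inner L (λ k → y (v , k)) (λ k → y (v , k))) ⟩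
        (μ * μ) * 𝔼 V (λ v → inner L (λ k → y (v , k)) (λ k → y (v , k)))
          ≡⟨ cong ((μ * μ) *_) (𝔼-⊗ V L (λ z → y z * y z)) ⟨
        (μ * μ) * Y ∎
        where open ℚ.≤-Reasoning

      norm-rotate : ∀ f → inner (V ⊗ L) (f ∘ Rot G) (f ∘ Rot G) ≡ inner (V ⊗ L) f f
      norm-rotate f = 𝔼-↔ (V ⊗ L) (V ⊗ L) (rotation G) (λ z → f z * f z)

      ⟨_,_⟩ : (f g : Carrier (V ⊗ L) → ℚ) → ℚ
      ⟨ f , g ⟩ = inner (V ⊗ L) (f ∘ Rot G) g

      -- Since `x` depends only on the vertex of `G`, pairing it with its rotation gives the form of
      -- `G` at `s`, and `s` has mean zero.
      xx-bound : ∣ ⟨ x , x ⟩ ∣ ≤ c * X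
      xx-bound = subst₂ (λ p q → ∣ p ∣ ≤ c * q) (inner-walk G s s) (sym X≡s²) (G-bound s s⊥1)

      -- The weight `μ` matches `E ≤ μ² Y`: each cross term is then at most half of `μ (X + Y)`, so
      -- the two together cost `μ`.
      xe-bound : (μ + μ) * ∣ ⟨ x , e ⟩ ∣ ≤ (μ * μ) * X + E
      xe-bound = subst (λ p → (μ + μ) * ∣ ⟨ x , e ⟩ ∣ ≤ (μ * μ) * p + E) (norm-rotate x)
        (am-gm (V ⊗ L) μ (x ∘ Rot G) e 0≤μ)

      ex-bound : (μ + μ) * ∣ ⟨ e , x ⟩ ∣ ≤ (μ * μ) * X + E
      ex-bound = subst₂ (λ p q → (μ + μ) * ∣ p ∣ ≤ (μ * μ) * X + q)
        (inner-comm (V ⊗ L) x (e ∘ Rot G)) (norm-rotate e) (am-gm (V ⊗ L) μ x (e ∘ Rot G) 0≤μ)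

      ee-bound : (1ℚ + 1ℚ) * ∣ ⟨ e , e ⟩ ∣ ≤ E + E
      ee-bound = subst (λ p → (1ℚ + 1ℚ) * ∣ ⟨ e , e ⟩ ∣ ≤ p + E)
        (trans (ℚ.*-identityˡ _) (norm-rotate e)) (am-gm (V ⊗ L) 1ℚ (e ∘ Rot G) e (ℚ.nonNegative⁻¹ 1ℚ))

      form-expand : ∣ inner (V ⊗ L) (walk (zigzag G H) a) a ∣ ≤
                    ∣ ⟨ x , x ⟩ ∣ + ∣ ⟨ x , e ⟩ ∣ + ∣ ⟨ e , x ⟩ ∣ + ∣ ⟨ e , e ⟩ ∣
      form-expand = begin
        ∣ inner (V ⊗ L) (walk (zigzag G H) a) a ∣
          ≡⟨ cong ∣_∣ (trans (form-zigzag a) (inner-cong (V ⊗ L) (λ z → fibreWalk≡x+e (Rot G z)) fibreWalk≡x+e)) ⟩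
        ∣ inner (V ⊗ L) (λ z → x (Rot G z) + e (Rot G z)) (λ z → x z + e z) ∣
          ≡⟨ cong ∣_∣ (inner-+ (V ⊗ L) (x ∘ Rot G) (e ∘ Rot G) x e) ⟩
        ∣ ⟨ x , x ⟩ + ⟨ x , e ⟩ + ⟨ e , x ⟩ + ⟨ e , e ⟩ ∣
          ≤⟨ ℚ.∣p+q∣≤∣p∣+∣q∣ (⟨ x , x ⟩ + ⟨ x , e ⟩ + ⟨ e , x ⟩) ⟨ e , e ⟩ ⟩
        ∣ ⟨ x , x ⟩ + ⟨ x , e ⟩ + ⟨ e , x ⟩ ∣ + ∣ ⟨ e , e ⟩ ∣
          ≤⟨ ℚ.+-monoˡ-≤ ∣ ⟨ e , e ⟩ ∣ (ℚ.∣p+q∣≤∣p∣+∣q∣ (⟨ x , x ⟩ + ⟨ x , e ⟩) ⟨ e , x ⟩) ⟩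
        ∣ ⟨ x , x ⟩ + ⟨ x , e ⟩ ∣ + ∣ ⟨ e , x ⟩ ∣ + ∣ ⟨ e , e ⟩ ∣
          ≤⟨ ℚ.+-monoˡ-≤ ∣ ⟨ e , e ⟩ ∣ (ℚ.+-monoˡ-≤ ∣ ⟨ e , x ⟩ ∣ (ℚ.∣p+q∣≤∣p∣+∣q∣ ⟨ x , x ⟩ ⟨ x , e ⟩)) ⟩
        ∣ ⟨ x , x ⟩ ∣ + ∣ ⟨ x , e ⟩ ∣ + ∣ ⟨ e , x ⟩ ∣ + ∣ ⟨ e , e ⟩ ∣ ∎
        where open ℚ.≤-Reasoning

      -- The arithmetic of the four bounds, with variables in place of the absolute values. The
      -- total is at most `c X + μ (X + Y) + μ² Y`; everything is multiplied by `2 μ` to avoid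
      -- division.
      combine-bounds : ∀ {p q r t f} → f ≤ p + q + r + t → p ≤ c * X →
        (μ + μ) * q ≤ (μ * μ) * X + E → (μ + μ) * r ≤ (μ * μ) * X + E → (1ℚ + 1ℚ) * t ≤ E + E →
        f ≤ (c + μ + μ * μ) * (X + Y)
      combine-bounds {p} {q} {r} {t} {f} f≤ p≤ q≤ r≤ t≤ = ℚ.*-cancelˡ-≤-pos (μ + μ) (begin
        (μ + μ) * f
          ≤⟨ mono 0≤2μ f≤ ⟩
        (μ + μ) * (p + q + r + t)
          ≡⟨ solve 5 (λ m p q r t → (m :+ m) :* (p :+ q :+ r :+ t) :=
               (m :+ m) :* p :+ (m :+ m) :* q :+ (m :+ m) :* r :+ m :* ((con 1ℚ :+ con 1ℚ) :* t)) refl μ p q r t ⟩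
        (μ + μ) * p + (μ + μ) * q + (μ + μ) * r + μ * ((1ℚ + 1ℚ) * t)
          ≤⟨ ℚ.+-mono-≤ (ℚ.+-mono-≤ (ℚ.+-mono-≤ (mono 0≤2μ p≤) q≤) r≤) (mono 0≤μ t≤) ⟩
        (μ + μ) * (c * X) + ((μ * μ) * X + E) + ((μ * μ) * X + E) + μ * (E + E)
          ≡⟨ solve 4 (λ m c X E → (m :+ m) :* (c :* X) :+ (m :* m :* X :+ E) :+ (m :* m :* X :+ E) :+ m :* (E :+ E) :=
               (m :+ m) :* (c :+ m) :* X :+ (con 1ℚ :+ con 1ℚ :+ (m :+ m)) :* E) refl μ c X E ⟩
        (μ + μ) * (c + μ) * X + (1ℚ + 1ℚ + (μ + μ)) * E
          ≤⟨ ℚ.+-monoʳ-≤ ((μ + μ) * (c + μ) * X) (mono (0≤p+q (ℚ.nonNegative⁻¹ (1ℚ + 1ℚ)) 0≤2μ) E≤μ²Y) ⟩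
        (μ + μ) * (c + μ) * X + (1ℚ + 1ℚ + (μ + μ)) * ((μ * μ) * Y)
          ≤⟨ ≤-arith (0≤p*q 0≤2μ (0≤p+q (0≤p*q (0≤p² μ) (0≤inner (V ⊗ L) x)) (0≤p*q 0≤c (0≤inner (V ⊗ L) y))))
               (solve 4 (λ m c X Y → (m :+ m) :* ((c :+ m :+ m :* m) :* (X :+ Y)) :-
                  ((m :+ m) :* (c :+ m) :* X :+ (con 1ℚ :+ con 1ℚ :+ (m :+ m)) :* ((m :* m) :* Y)) :=
                  (m :+ m) :* (m :* m :* X :+ c :* Y) :- con 0ℚ) refl μ c X Y) ⟩
        (μ + μ) * ((c + μ + μ * μ) * (X + Y)) ∎)
        where
        open ℚ.≤-Reasoning
        0≤2μ : 0ℚ ≤ μ + μ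
        0≤2μ = 0≤p+q 0≤μ 0≤μ
        mono : ∀ {r u v} → 0ℚ ≤ r → u ≤ v → r * u ≤ r * v
        mono {r} 0≤r = ℚ.*-monoˡ-≤-nonNeg r {{ℚ.nonNegative 0≤r}}
        instance
          2μ>0 : Positive (μ + μ)
          2μ>0 = ℚ.pos+pos⇒pos μ μ

      form-bound : ∣ inner (V ⊗ L) (walk (zigzag G H) a) a ∣ ≤ (c + μ + μ * μ) * inner (V ⊗ L) a a
      form-bound = subst (λ p → ∣ inner (V ⊗ L) (walk (zigzag G H) a) a ∣ ≤ (c + μ + μ * μ) * p) (sym pythagoras)
        (combine-bounds form-expand xx-bound xe-bound ex-bound ee-bound)

    FormBound-zigzag : ∀ c μ → 0ℚ ≤ c → .{{_ : Positive μ}} → FormBound G c → NormBound H μ →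
                       FormBound (zigzag G H) (c + μ + μ * μ)
    FormBound-zigzag = Decomposition.form-bound

open Spectrum

-- Passing between rational and real inequalities.

module Transfer where

  open import Data.Rational.Base using (_+_; _*_)

  ≤-by-ε : ∀ {p q} → (∀ ε .{{_ : Positive ε}} → p ≤ q + ε) → p ≤ q
  ≤-by-ε {p} {q} h with p ℚ.≤? q
  ... | yes p≤q = p≤q
  ... | no  p≰q = contradiction (≤-arith (ℚ.+-mono-≤ half half)
      (solve 2 (λ p q → let r = q :+ con ½ :* (p :- q) in q :- p := (r :+ r) :- (p :+ p)) refl p q)) p≰q
    where
    instance
      p-q>0 : Positive (p - q)
      p-q>0 = ℚ.positive (subst (ℚ._< p - q) (ℚ.+-inverseʳ q) (ℚ.+-monoˡ-< (- q) (ℚ.≰⇒> p≰q)))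
    half : p ≤ q + ε/2 (p - q)
    -- Half of the gap `p - q` as `ε` puts `p` at or below the midpoint of `q` and `p`, which
    -- contradicts `q < p`.
    half = h (ε/2 (p - q)) {{half-pos (p - q)}}

  fromℚ≃0⇒≡0 : ∀ {q} → fromℚ q ≃ᵣ 0ᵣ → q ≡ 0ℚ
  fromℚ≃0⇒≡0 {q} h = ℚ.∣p∣≡0⇒p≡0 q (ℚ.≤-antisym (≤-by-ε λ ε → let N , close = h ε in begin
    ∣ q ∣        ≡⟨ cong ∣_∣ (ℚ.+-identityʳ q) ⟨
    ∣ q - 0ℚ ∣   ≤⟨ close N ℕ.≤-refl ⟩
    ε            ≡⟨ ℚ.+-identityˡ ε ⟨
    0ℚ + ε       ∎) (ℚ.0≤∣p∣ q))
    where open ℚ.≤-Reasoning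

  ⁺≡id : ∀ {p} → 0ℚ ≤ p → p ⁺ ≡ p
  ⁺≡id = ℚ.p≥q⇒p⊔q≡p

  positive-below : ∀ δ .{{_ : Positive δ}} → ∃[ δ′ ] Positive δ′ × δ′ ≤ δ × δ′ ≤ 1ℚ
  positive-below δ {{δ>0}} with ℚ.≤-total δ 1ℚ
  ... | inj₁ δ≤1 = δ , ℚ.positive (ℚ.positive⁻¹ δ) , ℚ.≤-refl , δ≤1
  ... | inj₂ 1≤δ = 1ℚ , _ , 1≤δ , ℚ.≤-refl

  -- The width of the bisection interval is absorbed into ε.
  bisect-cancel-≤ : ∀ {p q} c → 0ℚ ≤ p → 0ℚ ≤ q →
    (∀ ε .{{_ : Positive ε}} → ∃[ N ] (∀ n → N ℕ.≤ n → bisect p n ≤ c * bisect q n + ε)) →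
    p ≤ (c * c) * q
  bisect-cancel-≤ {p} {q} c 0≤p 0≤q h = ≤-by-ε λ ε →
    let δ₀ , δ₀>0 , eq        = quotient ε K K>0
        δ , δ>0 , δ≤δ₀ , δ≤1  = positive-below δ₀ {{δ₀>0}}
        e>0                   = half-pos δ {{δ>0}}
        0≤δ                   = ℚ.<⇒≤ (ℚ.positive⁻¹ δ {{δ>0}})
        N , hN                = h (ε/2 δ) {{e>0}}
        M , hM                = width-small (fromℚ p) (ε/2 δ) {{e>0}}
        n                     = N ⊔ M
        b                     = bisect q n
        w≤                    = subst (λ r → width r n ≤ ε/2 δ) (⁺≡id 0≤p) (hM n (ℕ.m≤n⊔m N M))
        u≤                    = ℚ.≤-trans (ℚ.+-mono-≤ (hN n (ℕ.m≤m⊔n N M)) w≤) (ℚ.≤-reflexive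
                                  (trans (ℚ.+-assoc (c * b) (ε/2 δ) (ε/2 δ)) (cong (c * b +_) (half+half δ))))
        0≤u                   = 0≤p+q (0≤bisect 0≤p n) (0≤width 0≤p n)
    in begin
      p
        ≤⟨ ≤bisect² 0≤p n ⟩
      (bisect p n + width p n) * (bisect p n + width p n)
        ≤⟨ *-mono-≤ 0≤u u≤ 0≤u u≤ ⟩
      (c * b + δ) * (c * b + δ)
        -- Uses `2 c b ≤ c² + b²` and `δ² ≤ δ`, the latter because `δ ≤ 1`. The coefficient of `δ`
        -- is at most `K` by `b² ≤ q`, and `K * δ₀` is `ε`.
        ≤⟨ ≤-arith (0≤p*q 0≤δ (0≤p+q (0≤p² (c - b)) (≤-arith δ≤1
             (solve 1 (λ d → (con 1ℚ :- d) :- con 0ℚ := con 1ℚ :- d) refl δ))))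
             (solve 3 (λ c b d →
               ((c :* c) :* (b :* b) :+ (c :* c :+ b :* b :+ con 1ℚ) :* d) :- (c :* b :+ d) :* (c :* b :+ d) :=
               d :* ((c :- b) :* (c :- b) :+ (con 1ℚ :- d)) :- con 0ℚ) refl c b δ) ⟩
      (c * c) * (b * b) + (c * c + b * b + 1ℚ) * δ
        ≤⟨ ℚ.+-mono-≤
             (ℚ.*-monoˡ-≤-nonNeg (c * c) {{ℚ.nonNegative (0≤p² c)}} (bisect²≤ 0≤q n))
             (*-mono-≤ (0≤p+q (0≤p+q (0≤p² c) (0≤p² b)) (ℚ.nonNegative⁻¹ 1ℚ))
               (ℚ.+-monoˡ-≤ 1ℚ (ℚ.+-monoʳ-≤ (c * c) (bisect²≤ 0≤q n))) 0≤δ δ≤δ₀) ⟩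
      (c * c) * q + K * δ₀
        ≡⟨ cong ((c * c) * q +_) eq ⟩
      (c * c) * q + ε ∎
    where
    open ℚ.≤-Reasoning
    K : ℚ
    K = c * c + q + 1ℚ
    K>0 : Positive K
    K>0 = ℚ.nonNeg+pos⇒pos (c * c + q) {{ℚ.nonNegative (0≤p+q (0≤p² c) 0≤q)}} 1ℚ

  opaque
    unfolding edges

    toℚ-edges : ∀ {V L} (G : Graph V L) u v → toℚ (edges G u v) ≡
      ∑ L (λ i → ∑ L (λ j → indicator (≡-dec (FinSet._≟_ V) (FinSet._≟_ L) (Rot G (u , i)) (v , j))))
    toℚ-edges {V} {L} G u v = begin
      toℚ (edges G u v)
        ≡⟨ toℚ-length-filter (λ (i , j) → match i j) (cartesianProduct (elements L) (elements L)) ⟩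
      sumList (λ (i , j) → indicator (match i j)) (cartesianProduct (elements L) (elements L))
        ≡⟨ sumList-cartesianProduct (λ (i , j) → indicator (match i j)) (elements L) (elements L) ⟩
      sumList (λ i → sumList (λ j → indicator (match i j)) (elements L)) (elements L)
        ≡⟨ sumList-elements L (λ i → sumList (λ j → indicator (match i j)) (elements L)) ⟩
      ∑ L (λ i → sumList (λ j → indicator (match i j)) (elements L))
        ≡⟨ ∑-cong L (λ i → sumList-elements L (λ j → indicator (match i j))) ⟩
      ∑ L (λ i → ∑ L (λ j → indicator (match i j))) ∎
      where
      open ≡-Reasoning
      match : ∀ i j → Dec (Rot G (u , i) ≡ (v , j))
      match i j = ≡-dec (FinSet._≟_ V) (FinSet._≟_ L) (Rot G (u , i)) (v , j)

  -- For a fixed label `i` exactly one pair `(v , j)` equals `Rot G (u , i)`, so once the sum over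
  -- `i` is outermost the indicators leave a single term.
  ∑-edges : ∀ {V L} (G : Graph V L) (a : Carrier V → ℚ) u →
            ∑ V (λ v → toℚ (edges G u v) * a v) ≡ ∑ L (λ i → a (neighbour G (u , i)))
  ∑-edges {V} {L} G a u = begin
    ∑ V (λ v → toℚ (edges G u v) * a v)
      ≡⟨ ∑-cong V (λ v → begin
           toℚ (edges G u v) * a v                          ≡⟨ ℚ.*-comm (toℚ (edges G u v)) (a v) ⟩
           a v * toℚ (edges G u v)                          ≡⟨ cong (a v *_) (toℚ-edges G u v) ⟩
           a v * ∑ L (λ i → ∑ L (λ j → δ i (v , j)))        ≡⟨ ∑-*ˡ L (a v) (λ i → ∑ L (λ j → δ i (v , j))) ⟨
           ∑ L (λ i → a v * ∑ L (λ j → δ i (v , j)))        ≡⟨ ∑-cong L (λ i → ∑-*ˡ L (a v) (λ j → δ i (v , j))) ⟨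
           ∑ L (λ i → ∑ L (λ j → a v * δ i (v , j)))        ∎) ⟩
    ∑ V (λ v → ∑ L (λ i → ∑ L (λ j → a v * δ i (v , j))))
      ≡⟨ ∑-swap V L (λ v i → ∑ L (λ j → a v * δ i (v , j))) ⟩
    ∑ L (λ i → ∑ V (λ v → ∑ L (λ j → a v * δ i (v , j))))
      ≡⟨ ∑-cong L (λ i → begin
           ∑ V (λ v → ∑ L (λ j → a v * δ i (v , j)))        ≡⟨ ∑-⊗ V L (λ x → a (proj₁ x) * δ i x) ⟨
           ∑ (V ⊗ L) (λ x → a (proj₁ x) * δ i x)
             ≡⟨ ∑-single (V ⊗ L) (λ x → a (proj₁ x) * δ i x) (Rot G (u , i)) (off i) ⟩
           a (neighbour G (u , i)) * δ i (Rot G (u , i))    ≡⟨ on i ⟩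
           a (neighbour G (u , i))                          ∎) ⟩
    ∑ L (λ i → a (neighbour G (u , i))) ∎
    where
    open ≡-Reasoning
    match : ∀ i x → Dec (Rot G (u , i) ≡ x)
    match i x = ≡-dec (FinSet._≟_ V) (FinSet._≟_ L) (Rot G (u , i)) x
    δ : Carrier L → Carrier (V ⊗ L) → ℚ
    δ i x = indicator (match i x)
    off : ∀ i x → x ≢ Rot G (u , i) → a (proj₁ x) * δ i x ≡ 0ℚ
    off i x x≢ with match i x
    ... | yes eq = contradiction (sym eq) x≢
    ... | no  _  = ℚ.*-zeroʳ (a (proj₁ x))
    on : ∀ i → a (neighbour G (u , i)) * δ i (Rot G (u , i)) ≡ a (neighbour G (u , i))
    on i with match i (Rot G (u , i))
    ... | yes _ = ℚ.*-identityʳ (a (neighbour G (u , i)))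
    ... | no ¬eq = contradiction refl ¬eq

  -- The adjacency matrix as a walk operator, and the eigenvalue bound.

  module _ {V L : FinSet} (G : Graph V L) where

    open Euclidean V

    -- The matrix entries are constant sequences, so the real matrix acts on each term of `α` as the
    -- rational walk.
    seq-apply : ∀ α u n → seq (apply (adjacency G) α u) n ≡ walk G (λ v → seq (α v) n) u
    seq-apply α u n = begin
      seq (apply (adjacency G) α u) n
        ≡⟨ seq-Σᵣ V (λ v → adjacency G u v *ᵣ α v) n ⟩
      ∑ V (λ v → seq (adjacency G u v) n * a v)
        ≡⟨ ∑-cong V (λ v → trans (cong (_* a v) (/≡*recip (edges G u v) (size L)))
                                 (ℚ.*-assoc (recip (size L)) (toℚ (edges G u v)) (a v))) ⟩
      ∑ V (λ v → recip (size L) * (toℚ (edges G u v) * a v))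
        ≡⟨ ∑-*ˡ V (recip (size L)) (λ v → toℚ (edges G u v) * a v) ⟩
      recip (size L) * ∑ V (λ v → toℚ (edges G u v) * a v)
        ≡⟨ cong (recip (size L) *_) (∑-edges G a u) ⟩
      recip (size L) * ∑ L (λ i → a (neighbour G (u , i)))
        ≡⟨ 𝔼-def L (λ i → a (neighbour G (u , i))) ⟨
      walk G a u ∎
      where
      open ≡-Reasoning
      a : Carrier V → ℚ
      a v = seq (α v) n

    seq-norm² : ∀ α n → seq ⟨ α , α ⟩ n ≡ toℚ (size V) * inner V (λ v → seq (α v) n) (λ v → seq (α v) n)
    seq-norm² α n = trans (seq-Σᵣ V (λ v → α v *ᵣ α v) n) (sym (size*𝔼 V (λ v → seq (α v) n * seq (α v) n)))

    seq-apply-norm² : ∀ α n → seq ⟨ apply (adjacency G) α , apply (adjacency G) α ⟩ n ≡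
      toℚ (size V) * inner V (walk G (λ v → seq (α v) n)) (walk G (λ v → seq (α v) n))
    seq-apply-norm² α n = trans (seq-norm² (apply (adjacency G) α) n)
      (cong (toℚ (size V) *_) (inner-cong V (λ v → seq-apply α v n) (λ v → seq-apply α v n)))

    private
      N : ℚ
      N = toℚ (size V)

      0≤N : 0ℚ ≤ N
      0≤N = 0≤toℚ (size V)

      instance
        N>0 : Positive N
        N>0 = ℚ.positive (ℚ.<-≤-trans (ℚ.positive⁻¹ 1ℚ) (1≤toℚ (size V)))

    -- Applies the hypothesis to constant sequences. It speaks only of nonzero vectors, so the
    -- argument is by contradiction: if the inequality fails then `a` is not zero, because at zero
    -- both sides vanish.
    secondEigenvalue⇒norm : ∀ c → SecondEigenvalue≤ G (fromℚ c) → NormBound G c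
    secondEigenvalue⇒norm c (_ , h) a a⊥1
      with inner V (walk G a) (walk G a) ℚ.≤? (c * c) * inner V a a
    ... | yes p≤q = p≤q
    ... | no  p≰q = contradiction (ℚ.*-cancelˡ-≤-pos N (ℚ.≤-trans
            (bisect-cancel-≤ c 0≤P 0≤Q bound)
            (ℚ.≤-reflexive (solve 3 (λ c n q → (c :* c) :* (n :* q) := n :* ((c :* c) :* q)) refl c N (inner V a a)))))
            p≰q
      where
      α : Vec
      α v = fromℚ (a v)

      P Q : ℚ
      P = N * inner V (walk G a) (walk G a)
      Q = N * inner V a a

      0≤P : 0ℚ ≤ P
      0≤P = 0≤p*q 0≤N (0≤inner V (walk G a))
      0≤Q : 0ℚ ≤ Q
      0≤Q = 0≤p*q 0≤N (0≤inner V a)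

      α⊥𝟙 : α ⊥ 𝟙
      α⊥𝟙 ε = 0 , λ n _ → subst (λ p → ∣ p - 0ℚ ∣ ≤ ε) (sym (begin
        seq ⟨ α , 𝟙 ⟩ n          ≡⟨ seq-Σᵣ V (λ v → α v *ᵣ 1ᵣ) n ⟩
        ∑ V (λ v → a v * 1ℚ)     ≡⟨ ∑-cong V (λ v → ℚ.*-identityʳ (a v)) ⟩
        ∑ V a                    ≡⟨ size*𝔼 V a ⟨
        N * 𝔼 V a                ≡⟨ cong (N *_) a⊥1 ⟩
        N * 0ℚ                   ≡⟨ ℚ.*-zeroʳ N ⟩
        0ℚ                       ∎)) (ℚ.<⇒≤ (ℚ.positive⁻¹ ε))
        where open ≡-Reasoning

      α≢𝟘 : ¬ (∀ v → α v ≃ᵣ 𝟘 v)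
      α≢𝟘 α≃𝟘 = p≰q (ℚ.≤-trans (ℚ.≤-reflexive (begin
        inner V (walk G a) (walk G a)   ≡⟨ inner-cong V walk≡0 walk≡0 ⟩
        𝔼 V (λ _ → 0ℚ * 0ℚ)             ≡⟨ 𝔼-const V (0ℚ * 0ℚ) ⟩
        0ℚ                              ∎)) (0≤p*q (0≤p² c) (0≤inner V a)))
        where
        open ≡-Reasoning
        walk≡0 : ∀ v → walk G a v ≡ 0ℚ
        walk≡0 v = trans (walk-cong G {b = λ _ → 0ℚ} (λ w → fromℚ≃0⇒≡0 {a w} (α≃𝟘 w)) v) (walk-const G 0ℚ v)

      bound : ∀ ε .{{_ : Positive ε}} → ∃[ M ] (∀ n → M ℕ.≤ n → bisect P n ≤ c * bisect Q n + ε)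
      bound ε = let M , hM = h α α⊥𝟙 α≢𝟘 ε in M , λ n M≤n → subst₂ (λ p q → bisect p n ≤ c * bisect q n + ε)
        (trans (cong _⁺ (seq-apply-norm² α n)) (⁺≡id 0≤P))
        (trans (cong _⁺ (seq-norm² α n)) (⁺≡id 0≤Q))
        (hM n M≤n)

    -- Subtraction of the mean, spelled as a combination with two coefficients so that the linearity
    -- lemmas apply to it directly.
    centre : (Carrier V → ℚ) → Carrier V → ℚ
    centre a v = 1ℚ * a v + (- 𝔼 V a) * 1ℚ

    𝔼-centre : ∀ a → 𝔼 V (centre a) ≡ 0ℚ
    𝔼-centre a = begin
      𝔼 V (centre a)                               ≡⟨ 𝔼-linear V 1ℚ (- 𝔼 V a) a (λ _ → 1ℚ) ⟩
      1ℚ * 𝔼 V a + (- 𝔼 V a) * 𝔼 V (λ _ → 1ℚ)      ≡⟨ cong (λ p → 1ℚ * 𝔼 V a + (- 𝔼 V a) * p) (𝔼-const V 1ℚ) ⟩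
      1ℚ * 𝔼 V a + (- 𝔼 V a) * 1ℚ                  ≡⟨ solve 1 (λ m → con 1ℚ :* m :+ (:- m) :* con 1ℚ := con 0ℚ) refl (𝔼 V a) ⟩
      0ℚ                                           ∎
      where open ≡-Reasoning

    variance : ∀ a → inner V (centre a) (centre a) ≡ inner V a a - 𝔼 V a * 𝔼 V a
    variance a = begin
      inner V (centre a) (centre a)
        ≡⟨ inner-linearˡ V 1ℚ (- m) a one (centre a) ⟩
      1ℚ * inner V a (centre a) + (- m) * inner V one (centre a)
        ≡⟨ cong₂ (λ p q → 1ℚ * p + (- m) * q)
             (trans (inner-linearʳ V 1ℚ (- m) a a one)
               (cong (λ p → 1ℚ * inner V a a + (- m) * p) (𝔼-cong V (λ v → ℚ.*-identityʳ (a v)))))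
             (trans (𝔼-cong V (λ v → ℚ.*-identityˡ (centre a v))) (𝔼-centre a)) ⟩
      1ℚ * (1ℚ * inner V a a + (- m) * m) + (- m) * 0ℚ
        ≡⟨ solve 2 (λ p m → con 1ℚ :* (con 1ℚ :* p :+ (:- m) :* m) :+ (:- m) :* con 0ℚ := p :- m :* m)
             refl (inner V a a) m ⟩
      inner V a a - m * m ∎
      where
      open ≡-Reasoning
      m : ℚ
      m = 𝔼 V a
      one : Carrier V → ℚ
      one _ = 1ℚ

    walk-centre : ∀ a v → walk G (centre a) v ≡ centre (walk G a) v
    walk-centre a v = trans (walk-linear G 1ℚ (- 𝔼 V a) a (λ _ → 1ℚ) v)
      (cong₂ (λ p q → 1ℚ * walk G a v + (- p) * q) (sym (𝔼-walk G a)) (walk-const G 1ℚ v))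

    -- A real vector orthogonal to `𝟙` has terms whose means only tend to 0, so a bound for every
    -- `a` is needed. The walk preserves the mean `m`, hence centring takes `m²` off both squared
    -- norms; the term `c² m²` is dropped.
    norm-uncentred : ∀ c → NormBound G c → ∀ a →
      inner V (walk G a) (walk G a) ≤ (c * c) * inner V a a + 𝔼 V a * 𝔼 V a
    norm-uncentred c h a = ≤-arith
      (ℚ.+-mono-≤ (subst₂ (λ p q → p ≤ (c * c) * q)
        (trans (inner-cong V (walk-centre a) (walk-centre a)) (trans (variance (walk G a))
          (cong (λ m → inner V (walk G a) (walk G a) - m * m) (𝔼-walk G a))))
        (variance a) (h (centre a) (𝔼-centre a)))
        (0≤p*q (0≤p² c) (0≤p² (𝔼 V a))))
      (solve 4 (λ c p q m → ((c :* c) :* q :+ m :* m) :- p :=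
        ((c :* c) :* (q :- m :* m) :+ (c :* c) :* (m :* m)) :- ((p :- m :* m) :+ con 0ℚ))
        refl c (inner V (walk G a) (walk G a)) (inner V a a) (𝔼 V a))

    norm-uncentred-∑ : ∀ c → NormBound G c → ∀ a →
      N * inner V (walk G a) (walk G a) ≤ (c * c) * (N * inner V a a) + ∑ V a * ∑ V a
    norm-uncentred-∑ c h a = begin
      N * inner V (walk G a) (walk G a)
        ≤⟨ ℚ.*-monoˡ-≤-nonNeg N {{ℚ.nonNegative 0≤N}} (norm-uncentred c h a) ⟩
      N * ((c * c) * inner V a a + m * m)
        -- Replaces `N m²` by `(N m)²`, as `N ≥ 1`, so that the error is the square of the sum that
        -- orthogonality controls.
        ≤⟨ ≤-arith (0≤p*q (0≤p*q 0≤N (≤-arith (1≤toℚ (size V))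
             (solve 1 (λ n → (n :- con 1ℚ) :- con 0ℚ := n :- con 1ℚ) refl N))) (0≤p² m))
             (solve 4 (λ n c q m → ((c :* c) :* (n :* q) :+ (n :* m) :* (n :* m)) :- n :* ((c :* c) :* q :+ m :* m) :=
                (n :* (n :- con 1ℚ)) :* (m :* m) :- con 0ℚ) refl N c (inner V a a) m) ⟩
      (c * c) * (N * inner V a a) + (N * m) * (N * m)
        ≡⟨ cong (λ p → (c * c) * (N * inner V a a) + p * p) (size*𝔼 V a) ⟩
      (c * c) * (N * inner V a a) + ∑ V a * ∑ V a ∎
      where
      open ℚ.≤-Reasoning
      m : ℚ
      m = 𝔼 V a

    norm⇒secondEigenvalue : ∀ c → 0ℚ ≤ c → c ≤ 1ℚ → NormBound G c → SecondEigenvalue≤ G (fromℚ c)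
    norm⇒secondEigenvalue c 0≤c c≤1 h = (λ ε → 0 , λ _ _ → 0≤p+q 0≤c (ℚ.<⇒≤ (ℚ.positive⁻¹ ε))) , bound
      where
      bound : (α : Vec) → α ⊥ 𝟙 → ¬ (∀ v → α v ≃ᵣ 𝟘 v) → ‖ apply (adjacency G) α ‖ ≤ᵣ fromℚ c *ᵣ ‖ α ‖
      bound α α⊥𝟙 _ ε =
        let M , hM = α⊥𝟙 (ε/2 ε) {{half-pos ε}}
            K , hK = width-small ⟨ α , α ⟩ (ε/2 ε) {{half-pos ε}}
        in M ⊔ K , λ n le → step n (hM n (ℕ.m⊔n≤o⇒m≤o M K le)) (hK n (ℕ.m⊔n≤o⇒n≤o M K le))
        where
        step : ∀ n → ∣ seq ⟨ α , 𝟙 ⟩ n - 0ℚ ∣ ≤ ε/2 ε → width (seq ⟨ α , α ⟩ n ⁺) n ≤ ε/2 ε →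
               seq (‖ apply (adjacency G) α ‖) n ≤ c * seq (‖ α ‖) n + ε
        -- `root-lemma` absorbs two errors: the bisection width scaled by `c`, which stays below
        -- `ε/2` because `c ≤ 1`, and the squared sum of the terms, at most the square of `ε/2`.
        step n mean≤ width≤ = root-lemma {w = c * w} ε (0≤p*q 0≤c 0≤b) (0≤p*q 0≤c 0≤w)
          (ℚ.≤-trans (*-mono-≤ 0≤c c≤1 0≤w width≤) (ℚ.≤-reflexive (ℚ.*-identityˡ (ε/2 ε))))
          (begin
            bisect (p ⁺) n * bisect (p ⁺) n            ≤⟨ bisect²≤ (0≤⁺ p) n ⟩
            p ⁺                                        ≤⟨ ℚ.⊔-lub p≤ (0≤p+q (0≤p² (c * b + c * w)) (0≤p² (ε/2 ε))) ⟩
            (c * b + c * w) * (c * b + c * w) + ε/2 ε * ε/2 ε ∎)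
          where
          open ℚ.≤-Reasoning
          a : Carrier V → ℚ
          a v = seq (α v) n
          p q b w : ℚ
          p = seq ⟨ apply (adjacency G) α , apply (adjacency G) α ⟩ n
          q = seq ⟨ α , α ⟩ n
          b = bisect (q ⁺) n
          w = width (q ⁺) n
          0≤b : 0ℚ ≤ b
          0≤b = 0≤bisect (0≤⁺ q) n
          0≤w : 0ℚ ≤ w
          0≤w = 0≤width (0≤⁺ q) n
          seq-mean : seq ⟨ α , 𝟙 ⟩ n - 0ℚ ≡ ∑ V a
          seq-mean = trans (ℚ.+-identityʳ (seq ⟨ α , 𝟙 ⟩ n)) (trans (seq-Σᵣ V (λ v → α v *ᵣ 1ᵣ) n)
            (∑-cong V (λ v → ℚ.*-identityʳ (a v))))
          mean²≤ : ∑ V a * ∑ V a ≤ ε/2 ε * ε/2 ε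
          mean²≤ = begin
            ∑ V a * ∑ V a           ≤⟨ p≤∣p∣ (∑ V a * ∑ V a) ⟩
            ∣ ∑ V a * ∑ V a ∣       ≡⟨ ℚ.∣p*q∣≡∣p∣*∣q∣ (∑ V a) (∑ V a) ⟩
            ∣ ∑ V a ∣ * ∣ ∑ V a ∣   ≤⟨ *-mono-≤ (ℚ.0≤∣p∣ (∑ V a)) ∣mean∣≤ (ℚ.0≤∣p∣ (∑ V a)) ∣mean∣≤ ⟩
            ε/2 ε * ε/2 ε           ∎
            where
            ∣mean∣≤ : ∣ ∑ V a ∣ ≤ ε/2 ε
            ∣mean∣≤ = subst (λ m → ∣ m ∣ ≤ ε/2 ε) seq-mean mean≤
          p≤ : p ≤ (c * b + c * w) * (c * b + c * w) + ε/2 ε * ε/2 ε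
          p≤ = begin
            p
              ≡⟨ seq-apply-norm² α n ⟩
            N * inner V (walk G a) (walk G a)
              ≤⟨ norm-uncentred-∑ c h a ⟩
            (c * c) * (N * inner V a a) + ∑ V a * ∑ V a
              ≡⟨ cong (λ r → (c * c) * r + ∑ V a * ∑ V a) (seq-norm² α n) ⟨
            (c * c) * q + ∑ V a * ∑ V a
              ≤⟨ ℚ.+-mono-≤ (ℚ.*-monoˡ-≤-nonNeg (c * c) {{ℚ.nonNegative (0≤p² c)}}
                   (ℚ.≤-trans (ℚ.p≤p⊔q q 0ℚ) (≤bisect² (0≤⁺ q) n))) mean²≤ ⟩
            (c * c) * ((b + w) * (b + w)) + ε/2 ε * ε/2 ε
              ≡⟨ cong (_+ ε/2 ε * ε/2 ε) (solve 3 (λ c b w → (c :* c) :* ((b :+ w) :* (b :+ w)) :=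
                   (c :* b :+ c :* w) :* (c :* b :+ c :* w)) refl c b w) ⟩
            (c * b + c * w) * (c * b + c * w) + ε/2 ε * ε/2 ε ∎

open Transfer

-- The iterated sequence of graphs.

open import Data.Integer.Base using (+_)
open import Data.Nat.Base using (_*_)

module _ {V K : FinSet} (H : Graph V K) (φ : Carrier ((K ⊗ K) ⊗ (K ⊗ K)) ↔ Carrier V) where

  open Iteration H φ

  size-vertexSet : ∀ D → size V ≡ D ^ 4 → ∀ i → size (vertexSet (suc i)) ≡ D ^ (4 * suc i)
  size-vertexSet D eq zero    = eq
  size-vertexSet D eq (suc i) = begin
    size (vertexSet (suc i)) * size V   ≡⟨ cong₂ _*_ (size-vertexSet D eq i) eq ⟩
    D ^ (4 * suc i) * D ^ 4             ≡⟨ ℕ.^-distribˡ-+-* D (4 * suc i) 4 ⟨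
    D ^ (4 * suc i ℕ.+ 4)               ≡⟨ cong (D ^_) (ℕ.+-comm (4 * suc i) 4) ⟩
    D ^ (4 ℕ.+ 4 * suc i)               ≡⟨ cong (D ^_) (ℕ.*-suc 4 (suc i)) ⟨
    D ^ (4 * suc (suc i))               ∎
    where open ≡-Reasoning

  -- The induction carries the form bound, since that is what the zig-zag product yields;
  -- polarization supplies the norm bound needed before each squaring.
  FormBound-graph : NormBound H (+ 1 / 5) → ∀ i → FormBound (graph (suc i)) (+ 2 / 5)
  FormBound-graph h zero    = FormBound-mono (square H) {+ 1 / 25} {+ 2 / 5} (from-yes (+ 1 / 25 ℚ.≤? + 2 / 5))
    (FormBound-square H {+ 1 / 5} h)
  -- With `c = 4/25` and `μ = 1/5` the bound `c + μ + μ * μ` evaluates to `2/5`, so the induction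
  -- closes with the same constant.
  FormBound-graph h (suc i) = ZigZag.FormBound-zigzag G² H (+ 4 / 25) (+ 1 / 5) (ℚ.nonNegative⁻¹ (+ 4 / 25))
    (FormBound-relabel φ (square (graph (suc i))) {+ 4 / 25}
      (FormBound-square (graph (suc i)) {+ 2 / 5}
        (form⇒norm (graph (suc i)) (+ 2 / 5) (FormBound-graph h i))))
    h
    where
    G² : Graph (vertexSet (suc i)) V
    G² = relabel φ (square (graph (suc i)))

theorem1p4 : (D : ℕ) (V K : FinSet) (H : Graph V K) →
    IsGraph H (D ^ 4) D (fromℚ (+ 1 / 5)) →
    (φ : FinSet.Carrier ((K ⊗ K) ⊗ (K ⊗ K)) ↔ FinSet.Carrier V) →
    (i : ℕ) .{{_ : NonZero i}} →
    IsGraph (Iteration.graph H φ i) (D ^ (4 * i)) (D ^ 2) (fromℚ (+ 2 / 5))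
theorem1p4 D V K H h φ (suc i) = record
  { vertices = size-vertexSet H φ D (IsGraph.vertices h) i
  -- `D ^ 2` unfolds to `D * (D * 1)`, so the second factor needs the identity law.
  ; degree   = cong₂ _*_ degree (trans degree (sym (ℕ.*-identityʳ D)))
  ; bound    = norm⇒secondEigenvalue G (+ 2 / 5) (ℚ.nonNegative⁻¹ (+ 2 / 5)) (from-yes (+ 2 / 5 ℚ.≤? 1ℚ))
                 (form⇒norm G (+ 2 / 5)
                   (FormBound-graph H φ (secondEigenvalue⇒norm H (+ 1 / 5) (IsGraph.bound h)) i))
  }
  where
  degree : size K ≡ D
  degree = IsGraph.degree h
  G : Graph (Iteration.vertexSet H φ (suc i)) (K ⊗ K)
  G = Iteration.graph H φ (suc i)
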